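{- Let $w^H$ be the weight system of height $3$ on the lecture hall graph defined, for $0\le j\le i$, by \[ w^H(t;i,j)=\begin{cases}(q^j+q^{ -j})/2 & \text{if } t=0,\\ -q^{j-i}/2 & \text{if } t=1,\\ -q^{i-j}/2 & \text{if } t=2,\end{cases} \] (and $w^H(t;i,j)=0$ for $t\ge3$). Then the mixed moments $\sigma^H_{n,k}(q)$ of the continuous $q$-Hermite polynomials satisfy \[ \sigma^H_{n,k}(q)=h^{w^H}_{n,k}\qquad(n\ge k\ge0). \]
   Context: Lecture hall graph. For integers $t\ge0$, $0\le j\le i$ put $v^t_{i,j}=(i,\,t+\frac{j}{i+1})$, and set $v^t_{i,i+1}:=v^{t+1}_{i,0}$. The vertices of the lecture hall graph are all $v^t_{i,j}$; its edges join $v^t_{i,j}$ with $v^t_{i,j+1}$ (vertical edges) and $v^t_{i,j}$ with $v^t_{i+1,j}$, for $t\ge 0$, $0\le j\le i$. An east step is a directed edge $(v^t_{i,j},v^t_{i+1,j})$; a south step is a vertical edge directed downwards, $(v^t_{i,j+1},v^t_{i,j})$. A weight system $w$ assigns a weight $w(t;i,j)$ to each east step $(v^t_{i,j},v^t_{i+1,j})$; its height is the smallest integer $\ell$ with $w(t;i,j)=0$ for all $t\ge\ell$. The weight $w(p)$ of a path is the product of the weights of its east steps. $\mathrm{SE}((k,\infty)\to(n,0))$ is the set of paths $(\dots,v_2,v_1,v_0)$ with $v_0=(n,0)$, $\lim_{m\to\infty}v_m=(k,\infty)$, and each $(v_{m+1},v_m)$ a south or east step. Define $h^w_{n,k}=\sum_{p\in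 \mathrm{SE}((k,\infty)\to(n,0))}w(p)$ (so $h^w_{n,n}=1$). Continuous $q$-Hermite polynomials. With $x=\cos\theta$ and $\mathbf i=\sqrt{ -1}$, the monic continuous $q$-Hermite polynomials are $H_n(x|q)=\frac{e^{\mathbf in\theta}}{2^n}\,{}_2\phi_0\!\left(\begin{matrix}q^{ -n},0\\-\end{matrix};q,q^ne^{ -2\mathbf i\theta}\right)$, where ${}_2\phi_0(\alpha_1,\alpha_2;-;q,z)=\sum_{k\ge0}\frac{(\alpha_1;q)_k(\alpha_2;q)_k}{(q;q)_k}\big((-1)^kq^{\binom k2}\big)^{ -1}z^k$ and $(z;q)_k=\prod_{i=0}^{k-1}(1-zq^i)$. The mixed moments are defined by $x^n=\sum_{k=0}^n\sigma^H_{n,k}(q)H_k(x|q)$. Here $q$ is an indeterminate. -}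

module Defs where

open import Level using (Level; _⊔_)
open import Data.Nat.Base as ℕ using (ℕ; zero; suc; _≤_; _<_; z≤n; s≤s)
import Data.Nat.Properties as ℕₚ
open import Data.Nat.Combinatorics using (_C_)
open import Data.Integer.Base as ℤ using (ℤ; +_; -[1+_]; 0ℤ; 1ℤ; -1ℤ)
import Data.Integer.Properties as ℤₚ
open import Data.List.Base
  using (List; []; _∷_; _++_; map; foldr; replicate; upTo; cartesianProductWith)
open import Data.List.Relation.Unary.Any using (Any; here; there)
import Data.List.Relation.Unary.Unique.Setoid as Unique
import Data.List.Membership.Setoid as Membership
open import Data.Product.Base using (_×_; _,_; ∃-syntax; proj₁; proj₂)
open import Data.Sum.Base using (_⊎_; inj₁; inj₂)
open import Relation.Nullary.Decidable.Core using (does)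
open import Data.Bool.Base using (if_then_else_)
open import Relation.Binary.Bundles using (Setoid)
open import Relation.Binary.PropositionalEquality as ≡ using (_≡_; _≢_)
open import Algebra.Bundles using (CommutativeRing; Semiring)
open import Algebra.Apartness.Bundles using (HeytingField; HeytingCommutativeRing)
import Algebra.Apartness.Properties.HeytingCommutativeRing as HeytingProperties
import Algebra.Definitions.RawSemiring as RawSemiringDefs
import Algebra.Properties.CommutativeSemigroup as CommutativeSemigroupProperties
import Algebra.Properties.Ring as RingProperties
import Relation.Binary.Reasoning.Setoid as SetoidReasoning

------------------------------------------------------------------------
-- The lecture hall graph

-- The vertex v^t_{i,j}, that is, the point (i , t + j/(i+1)).  As 0 ≤ j ≤ i,
-- the labels (t, i, j) are determined by the point, and t is the integer
-- part of its second coordinate.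
record Vertex : Set where
  constructor vtx
  field
    t i j : ℕ
    .j≤i  : j ≤ i

-- Directed edges.  The vertical edge above v^t_{i,i} ends in
-- v^t_{i,i+1} = v^{t+1}_{i,0}, hence two constructors for south steps.
data Step : Vertex → Vertex → Set where
  east   : ∀ {t i j} .{p : j ≤ i} .{p′ : j ≤ suc i} →
           Step (vtx t i j p) (vtx t (suc i) j p′)
  south  : ∀ {t i j} .{p : suc j ≤ i} .{p′ : j ≤ i} →
           Step (vtx t i (suc j) p) (vtx t i j p′)
  south′ : ∀ {t i} .{p : 0 ≤ i} .{p′ : i ≤ i} →
           Step (vtx (suc t) i 0 p) (vtx t i i p′)

-- SE((k,∞) → (n,0)): paths (… , v₂ , v₁ , v₀), indexed from their end point.
-- Convergence to (k,∞) is spelled out in coordinates: the first one is an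
-- integer, so it is eventually equal to k; the second one is eventually at
-- least N, for every N, which only depends on its integer part t.
record SE (k n : ℕ) : Set where
  field
    vertex : ℕ → Vertex
    end    : vertex 0 ≡ vtx 0 n 0 z≤n
    step   : ∀ m → Step (vertex (suc m)) (vertex m)
    limit  : ∀ N → ∃[ M ] (∀ m → M ≤ m →
               (Vertex.i (vertex m) ≡ k) × (N ≤ Vertex.t (vertex m)))

SE-setoid : ℕ → ℕ → Setoid _ _
SE-setoid k n = record
  { Carrier       = SE k n
  ; _≈_           = λ p p′ → ∀ m → SE.vertex p m ≡ SE.vertex p′ m
  ; isEquivalence = record
    { refl  = λ _ → ≡.refl
    ; sym   = λ e m → ≡.sym (e m)
    ; trans = λ e e′ m → ≡.trans (e m) (e′ m)
    }
  }

------------------------------------------------------------------------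
-- Weights

module Weights {c ℓ₁ ℓ₂ : Level} (K : HeytingField c ℓ₁ ℓ₂) where
  open HeytingField K

  VanishesFrom : (ℕ → ℕ → ℕ → Carrier) → ℕ → Set ℓ₁
  VanishesFrom w ℓ = ∀ t i j → ℓ ≤ t → j ≤ i → w t i j ≈ 0#

  -- `weight t i j` is w(t;i,j); its values for j > i play no role.
  record WeightSystem : Set (c ⊔ ℓ₁) where
    field
      weight         : ℕ → ℕ → ℕ → Carrier
      height         : ℕ
      vanishes       : VanishesFrom weight height
      height-minimal : ∀ ℓ → VanishesFrom weight ℓ → height ≤ ℓ

  stepWeight : WeightSystem → ∀ {u v} → Step u v → Carrier
  stepWeight w (east {t} {i} {j}) = WeightSystem.weight w t i j
  stepWeight w south              = 1#
  stepWeight w south′             = 1#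

  -- From position M onwards the path stays in column k, so that all its east
  -- steps are among the first M steps.
  pathWeight : WeightSystem → ∀ {k n} → SE k n → Carrier
  pathWeight w p = foldr _*_ 1# (map (λ m → stepWeight w (SE.step p m)) (upTo M))
    where M = proj₁ (SE.limit p 0)

  -- `HasSum S f s` says that ∑_{p ∈ S} f(p) = s, where f vanishes outside a
  -- finite set.
  HasSum : ∀ {a b} (S : Setoid a b) → (Setoid.Carrier S → Carrier) →
           Carrier → Set (a ⊔ b ⊔ ℓ₁)
  HasSum S f s = ∃[ ps ]
      Unique.Unique S ps
    × (∀ p → (Membership._∈_ S p ps) ⊎ (f p ≈ 0#))
    × (foldr _+_ 0# (map f ps) ≈ s)

  -- h^w_{n,k} = s
  Is-h : WeightSystem → ℕ → ℕ → Carrier → Set ℓ₁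
  Is-h w n k s = HasSum (SE-setoid k n) (pathWeight w) s

------------------------------------------------------------------------
-- Indeterminates

module FieldOps {c ℓ₁ ℓ₂ : Level} (K : HeytingField c ℓ₁ ℓ₂) where
  open HeytingField K public
  open HeytingProperties heytingCommutativeRing public
  open HeytingCommutativeRing heytingCommutativeRing public
    using (commutativeRing)
  open CommutativeRing commutativeRing public
    using (ring; semiring; *-commutativeSemigroup)
  open RawSemiringDefs (Semiring.rawSemiring semiring) public
    using (_^_) renaming (_×_ to _·_)

  recip : ∀ x → x # 0# → Carrier
  recip x x#0 = proj₁ (#⇒invertible x#0)

  recip-inverseˡ : ∀ x x#0 → recip x x#0 * x ≈ 1#
  recip-inverseˡ x x#0 =
    trans (*-congˡ (sym (x-0≈x x))) (proj₁ (proj₂ (#⇒invertible x#0)))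

  fromℤ : ℤ → Carrier
  fromℤ (+ n)    = n · 1#
  fromℤ -[1+ n ] = - (suc n · 1#)

  evalℤ : List ℤ → Carrier → Carrier
  evalℤ as x = foldr (λ a r → fromℤ a + x * r) 0# as

  -- q is transcendental over the prime field (which then is ℚ): no polynomial
  -- with integer coefficients, not all zero, vanishes at q.
  Indeterminate : Carrier → Set ℓ₂
  Indeterminate q = ∀ (as : List ℤ) → Any (_≢ 0ℤ) as → evalℤ as q # 0#

------------------------------------------------------------------------
-- Laurent polynomials in one variable over K

module LaurentPolynomials {c ℓ₁ ℓ₂ : Level} (K : HeytingField c ℓ₁ ℓ₂) where
  open FieldOps K

  -- Finite formal sums of monomials a uᵉ, listed as pairs (e , a); an exponent
  -- may occur several times.
  Laurent : Set c
  Laurent = List (ℤ × Carrier)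

  coeff : Laurent → ℤ → Carrier
  coeff f m = foldr (λ (e , a) s → if does (e ℤₚ.≟ m) then a + s else s) 0# f

  infix 4 _≋_
  _≋_ : Laurent → Laurent → Set ℓ₁
  f ≋ g = ∀ m → coeff f m ≈ coeff g m

  infixl 6 _⊕_
  _⊕_ : Laurent → Laurent → Laurent
  _⊕_ = _++_

  infixl 7 _⊗_
  _⊗_ : Laurent → Laurent → Laurent
  _⊗_ = cartesianProductWith (λ (e , a) (e′ , a′) → (e ℤ.+ e′ , a * a′))

  monomial : ℤ → Carrier → Laurent
  monomial e a = (e , a) ∷ []

  const : Carrier → Laurent
  const = monomial 0ℤ

  infixr 8 _^ᴸ_
  _^ᴸ_ : Laurent → ℕ → Laurent
  f ^ᴸ zero  = const 1#
  f ^ᴸ suc n = f ⊗ f ^ᴸ n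

  -- ∑_{k=0}^{n} f k
  sum≤ : ℕ → (ℕ → Laurent) → Laurent
  sum≤ n f = foldr _⊕_ [] (map f (upTo (suc n)))

------------------------------------------------------------------------
-- Continuous q-Hermite polynomials

module QHermite {c ℓ₁ ℓ₂ : Level} (K : HeytingField c ℓ₁ ℓ₂)
                (q : HeytingField.Carrier K)
                (q-ind : FieldOps.Indeterminate K q) where
  open FieldOps K
  open LaurentPolynomials K public
  open Weights K public
  open RingProperties ring
    using (-‿distribʳ-*; -‿involutive)
  open CommutativeSemigroupProperties *-commutativeSemigroup using (interchange)

  private
    ≈-[_] : ∀ {x y} → x ≈ y → x # 0# → y # 0#
    ≈-[ e ] = #-congʳ e

    1·1 : 1 · 1# ≈ 1#
    1·1 = +-identityʳ 1#

    x+q0 : ∀ x → x + q * 0# ≈ x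
    x+q0 x = trans (+-congˡ (zeroʳ q)) (+-identityʳ x)

  2#0 : 1# + 1# # 0#
  2#0 = ≈-[ trans (x+q0 _) (+-congˡ 1·1) ] (q-ind (+ 2 ∷ []) (here λ ()))

  ½ : Carrier
  ½ = recip (1# + 1#) 2#0

  q#0 : q # 0#
  q#0 = ≈-[ trans (+-identityˡ _) (trans (*-congˡ (trans (x+q0 _) 1·1)) (*-identityʳ q)) ]
          (q-ind (0ℤ ∷ 1ℤ ∷ []) (there (here λ ())))

  1-q^#0 : ∀ k → 1# - q * q ^ k # 0#
  1-q^#0 k = ≈-[ +-cong 1·1 (trans (*-congˡ (tail k)) (sym (-‿distribʳ-* q (q ^ k)))) ]
               (q-ind (1ℤ ∷ replicate k 0ℤ ++ -1ℤ ∷ []) (here λ ()))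
    where
    tail : ∀ k → evalℤ (replicate k 0ℤ ++ -1ℤ ∷ []) q ≈ - (q ^ k)
    tail zero    = trans (x+q0 _) (-‿cong 1·1)
    tail (suc k) = trans (+-identityˡ _)
      (trans (*-congˡ (tail k)) (sym (-‿distribʳ-* q (q ^ k))))

  ^-#0 : ∀ {x} → x # 0# → ∀ n → x ^ n # 0#
  ^-#0 x#0 zero    = 1#0
  ^-#0 x#0 (suc n) = x#0y#0→xy#0 x#0 (^-#0 x#0 n)

  -1#0 : - 1# # 0#
  -1#0 = invertibleˡ⇒# (- 1# , trans (*-congˡ (x-0≈x _))
    (trans (sym (-‿distribʳ-* (- 1#) 1#))
      (trans (-‿cong (*-identityʳ _)) (-‿involutive 1#))))

  infixr 8 q^_
  q^_ : ℤ → Carrier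
  q^ (+ n)    = q ^ n
  q^ -[1+ n ] = recip q q#0 ^ suc n

  -- (z;q)_k
  qPoch : Carrier → ℕ → Carrier
  qPoch z zero    = 1#
  qPoch z (suc k) = qPoch z k * (1# - z * q ^ k)

  qPoch-q#0 : ∀ k → qPoch q k # 0#
  qPoch-q#0 zero    = 1#0
  qPoch-q#0 (suc k) = x#0y#0→xy#0 (qPoch-q#0 k) (1-q^#0 k)

  -- The coefficient of z^k in ₂φ₀(α₁,α₂;–;q,z).
  φ-coeff : Carrier → Carrier → ℕ → Carrier
  φ-coeff α₁ α₂ k =
      qPoch α₁ k * qPoch α₂ k * recip (qPoch q k) (qPoch-q#0 k)
    * recip ((- 1#) ^ k * q ^ (k C 2))
            (x#0y#0→xy#0 (^-#0 -1#0 k) (^-#0 q#0 (k C 2)))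

  -- The terminating series ₂φ₀(q⁻ⁿ,α;–;q,z); by `qPoch-terminates` the terms
  -- with k > n vanish.
  φ : ℕ → Carrier → Laurent → Laurent
  φ n α z = sum≤ n (λ k → const (φ-coeff (q^ (ℤ.- + n)) α k) ⊗ z ^ᴸ k)

  qPoch-terminates : ∀ {n k} → n < k → qPoch (q^ (ℤ.- + n)) k ≈ 0#
  qPoch-terminates {n} {suc k} (s≤s n≤k) with ℕₚ.m≤n⇒m<n∨m≡n n≤k
  ... | inj₁ n<k    = trans (*-congʳ (qPoch-terminates n<k)) (zeroˡ _)
  ... | inj₂ ≡.refl =
    trans (*-congˡ (trans (+-congˡ (-‿cong (cancel n))) (-‿inverseʳ 1#))) (zeroʳ _)
    where
    q⁻¹ = recip q q#0
    cancel′ : ∀ n → q⁻¹ ^ n * q ^ n ≈ 1#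
    cancel′ zero    = *-identityˡ 1#
    cancel′ (suc n) = begin
      (q⁻¹ * q⁻¹ ^ n) * (q * q ^ n)  ≈⟨ interchange q⁻¹ (q⁻¹ ^ n) q (q ^ n) ⟩
      (q⁻¹ * q) * (q⁻¹ ^ n * q ^ n)  ≈⟨ *-cong (recip-inverseˡ q q#0) (cancel′ n) ⟩
      1# * 1#                        ≈⟨ *-identityˡ 1# ⟩
      1#                             ∎
      where open SetoidReasoning setoid
    cancel : ∀ n → q^ (ℤ.- + n) * q ^ n ≈ 1#
    cancel zero    = *-identityˡ 1#
    cancel (suc n) = cancel′ (suc n)

  -- The variable of the Laurent polynomials stands for e^{𝐢θ}.
  e^i_θ : ℤ → Laurent
  e^i m θ = monomial m 1#

  -- x = cos θ = (e^{𝐢θ} + e^{-𝐢θ})/2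
  cosθ : Laurent
  cosθ = const ½ ⊗ (e^i 1ℤ θ ⊕ e^i -1ℤ θ)

  -- H_n(x|q), written in terms of e^{𝐢θ} where x = cos θ.
  H : ℕ → Laurent
  H n = const (½ ^ n) ⊗ e^i (+ n) θ ⊗ φ n 0# (const (q ^ n) ⊗ e^i (ℤ.- + 2) θ)

  -- σ n k is the mixed moment σ_{n,k}, for n ≥ k; the other values of σ play
  -- no role.
  IsMixedMoments : (ℕ → ℕ → Carrier) → Set ℓ₁
  IsMixedMoments σ = ∀ n → cosθ ^ᴸ n ≋ sum≤ n (λ k → const (σ n k) ⊗ H k)

  wᴴ : ℕ → ℕ → ℕ → Carrier
  wᴴ 0 i j = (q^ (+ j) + q^ (ℤ.- + j)) * ½
  wᴴ 1 i j = (- (q^ (+ j ℤ.- + i))) * ½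
  wᴴ 2 i j = (- (q^ (+ i ℤ.- + j))) * ½
  wᴴ (suc (suc (suc t))) i j = 0#

  wᴴ-system : WeightSystem
  wᴴ-system = record
    { weight         = wᴴ
    ; height         = 3
    ; vanishes       = vanishes
    ; height-minimal = λ ℓ v → ℕₚ.≮⇒≥ λ { (s≤s ℓ≤2) →
        #-irrefl (v 2 0 0 ℓ≤2 z≤n) (x#0y#0→xy#0 -1#0 ½#0) }
    }
    where
    vanishes : VanishesFrom wᴴ 3
    vanishes (suc (suc (suc t))) i j (s≤s (s≤s (s≤s z≤n))) j≤i = refl
    ½#0 : ½ # 0#
    ½#0 = invertibleʳ⇒# (1# + 1# ,
      trans (*-congʳ (x-0≈x ½)) (recip-inverseˡ (1# + 1#) 2#0))

{-# OPTIONS --safe #-}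
-- Let X be multiplication by x = cos θ on Laurent polynomials in e^{𝐢θ} and
-- λ_n = (1 - q^n)/4, so that X H_n = H_{n+1} + λ_n H_{n-1}.  Sums over paths
-- are computed slab by slab.  If u_i is the sum over the paths ending in
-- v^{t+1}_{i,0}, then the sum D(n,j) over the paths ending in v^t_{n+j,j}
-- satisfies
--   D(0,j) = u_j,   D(n+1,j) = D(n,j+1) + w(t;n+j,j) D(n,j).
-- This is linear in u, so one may start at t = 3 with u_i = H_i instead of the
-- scalars δ_{ki}.  Induction on n then shows for the slabs t = 2, 1, 0 that
--   X D₂(n,j) = D₂(n,j+1) + λ_j D₂(n,j-1) + q^j λ_n D₂(n-1,j),
--   X D₁(n,j) = D₁(n,j+1) + (q^{n+j}/2) D₁(n,j) + λ_j D₁(n,j-1),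
--   X D₀(n,j) = D₀(n,j+1) + ((q^j + q^{-j})/2) D₀(n,j).
-- For j = 0 the last line reads X D₀(n,0) = D₀(n+1,0), so D₀(n,0) = xⁿ, which
-- by linearity is ∑_k h_{n,k} H_k.
module Submission where

open import Defs
open import Data.Nat.Base using (ℕ; _≤_)
open import Data.Product.Base using (_×_; ∃)
open import Algebra.Apartness.Bundles using (HeytingField)
open import Level using (Level; _⊔_)
open import Data.Nat.Base as ℕ using (zero; suc; pred; _<_; z≤n; s≤s)
import Data.Nat.Properties as ℕₚ
import Data.Nat.Combinatorics as Combinatorics
open import Data.Nat.Combinatorics using (_C_)
open import Data.Integer.Base as ℤ using (ℤ; +_; -[1+_]; 0ℤ; 1ℤ; -1ℤ)
import Data.Integer.Properties as ℤₚ
import Data.Integer.Tactic.RingSolver as ℤ-Solver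
open import Data.Fin.Base using (Fin; toℕ)
import Data.Fin.Properties as Finₚ
open import Data.Empty using (⊥-elim-irr)
open import Data.List.Base using (List; []; _∷_; _++_; map; foldr; upTo; applyUpTo)
import Data.List.Properties as Listₚ
open import Data.List.Relation.Unary.Any using (here)
import Data.List.Relation.Unary.Any.Properties as Anyₚ
import Data.List.Relation.Unary.AllPairs as AllPairs
import Data.List.Relation.Unary.All as All
import Data.List.Relation.Unary.Unique.Setoid as Unique
import Data.List.Relation.Unary.Unique.Setoid.Properties as Uniqueₚ
import Data.List.Membership.Setoid as Membership
import Data.List.Membership.Setoid.Properties as Membershipₚ
open import Data.Product.Base using (_,_; ∃-syntax; proj₁; proj₂)
open import Data.Sum.Base as Sum using (_⊎_; inj₁; inj₂)
open import Function.Base using (_∘_; _$_; id)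
open import Relation.Nullary.Decidable.Core using (yes; no; recompute)
open import Relation.Nullary.Negation.Core using (contradiction)
open import Relation.Binary.Bundles using (Setoid)
open import Relation.Binary.PropositionalEquality as ≡ using (_≡_; _≢_)
open import Algebra.Apartness.Bundles using (HeytingCommutativeRing)
open import Algebra.Bundles using (CommutativeRing)
import Algebra.Properties.Ring as RingProperties
import Algebra.Properties.Semiring.Sum as SemiringSum
import Algebra.Solver.Ring.NaturalCoefficients.Default as NaturalSolver
import Relation.Binary.Reasoning.Setoid as SetoidReasoning

-- The lecture hall graph

module _ where
  open Vertex

  climb : Vertex → Vertex
  climb (vtx t i j h) with j ℕₚ.<? i
  ... | yes j<i = vtx t i (suc j) j<i
  ... | no  _   = vtx (suc t) i 0 z≤n

  climb-step : ∀ v → Step (climb v) v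
  climb-step (vtx t i j h) with j ℕₚ.<? i
  ... | yes j<i = south
  -- The bound `j ≤ i` is an irrelevant field; decidability recovers it, and with `j ≮ i` it forces
  -- `j = i`, the one place where a vertical edge passes to level `t + 1`.
  ... | no  j≮i with ℕₚ.≤-antisym (recompute (j ℕₚ.≤? i) h) (ℕₚ.≮⇒≥ j≮i)
  ...   | ≡.refl = south′

  climb-i : ∀ v → i (climb v) ≡ i v
  climb-i (vtx t i j h) with j ℕₚ.<? i
  ... | yes _ = ≡.refl
  ... | no  _ = ≡.refl

  -- The number of vertices below v in its column.
  rank : Vertex → ℕ
  rank v = t v ℕ.* suc (i v) ℕ.+ j v

  rank-climb : ∀ v → rank (climb v) ≡ suc (rank v)
  rank-climb (vtx t i j h) with j ℕₚ.<? i
  ... | yes j<i = ℕₚ.+-suc (t ℕ.* suc i) j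
  ... | no  j≮i with ℕₚ.≤-antisym (recompute (j ℕₚ.≤? i) h) (ℕₚ.≮⇒≥ j≮i)
  ...   | ≡.refl = ≡.trans (ℕₚ.+-identityʳ _) (≡.cong suc (ℕₚ.+-comm i (t ℕ.* suc i)))

  -- Vertical predecessors are unique, so a path that stays in its column is determined by its end
  -- point.
  vertical⇒climb : ∀ {u v} → Step u v → i u ≡ i v → u ≡ climb v
  vertical⇒climb (east {i = i}) e = contradiction (≡.sym e) ℕₚ.1+n≢n
  vertical⇒climb (south {i = i} {j} {p}) e with j ℕₚ.<? i
  ... | yes _   = ≡.refl
  ... | no  j≮i = ⊥-elim-irr (j≮i p)
  vertical⇒climb (south′ {i = i}) e with i ℕₚ.<? i
  ... | yes i<i = contradiction i<i (ℕₚ.<-irrefl ≡.refl)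
  ... | no  _   = ≡.refl

  step-i : ∀ {u v} → Step u v → i u ≤ i v
  step-i east   = ℕₚ.n≤1+n _
  step-i south  = ℕₚ.≤-refl
  step-i south′ = ℕₚ.≤-refl

  step-t : ∀ {u v} → Step u v → t v ≤ t u
  step-t east   = ℕₚ.≤-refl
  step-t south  = ℕₚ.≤-refl
  step-t south′ = ℕₚ.n≤1+n _

  ascent : Vertex → ℕ → Vertex
  ascent v zero    = v
  ascent v (suc m) = climb (ascent v m)

  ascent-i : ∀ v m → i (ascent v m) ≡ i v
  ascent-i v zero    = ≡.refl
  ascent-i v (suc m) = ≡.trans (climb-i (ascent v m)) (ascent-i v m)

  rank-ascent : ∀ v m → rank (ascent v m) ≡ m ℕ.+ rank v
  rank-ascent v zero    = ≡.refl
  rank-ascent v (suc m) = ≡.trans (rank-climb (ascent v m)) (≡.cong suc (rank-ascent v m))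

  -- Since `j ≤ i`, the rank is below `(t + 1)(i + 1)`, which excludes `t < N`.
  rank⇒t : ∀ v N → N ℕ.* suc (i v) ≤ rank v → N ≤ t v
  rank⇒t (vtx t i j h) N N≤ = ℕₚ.≮⇒≥ λ t<N → ℕₚ.<-irrefl ≡.refl $ begin-strict
    t ℕ.* suc i ℕ.+ j      <⟨ ℕₚ.+-monoʳ-< (t ℕ.* suc i) (s≤s (recompute (j ℕₚ.≤? i) h)) ⟩
    t ℕ.* suc i ℕ.+ suc i  ≡⟨ ℕₚ.+-comm (t ℕ.* suc i) (suc i) ⟩
    suc t ℕ.* suc i        ≤⟨ ℕₚ.*-monoˡ-≤ (suc i) t<N ⟩
    N ℕ.* suc i            ≤⟨ N≤ ⟩
    t ℕ.* suc i ℕ.+ j      ∎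
    where open ℕₚ.≤-Reasoning

-- SE((k,∞) → v) for an arbitrary end point v.
record Path (k : ℕ) (v : Vertex) : Set where
  field
    vertex : ℕ → Vertex
    end    : vertex 0 ≡ v
    step   : ∀ m → Step (vertex (suc m)) (vertex m)
    limit  : ∀ N → ∃[ M ] (∀ m → M ≤ m →
               (Vertex.i (vertex m) ≡ k) × (N ≤ Vertex.t (vertex m)))

open Path

Path-setoid : ℕ → Vertex → Setoid _ _
Path-setoid k v = record
  { Carrier       = Path k v
  ; _≈_           = λ p p′ → ∀ m → vertex p m ≡ vertex p′ m
  ; isEquivalence = record
    { refl  = λ _ → ≡.refl
    ; sym   = λ e m → ≡.sym (e m)
    ; trans = λ e e′ m → ≡.trans (e m) (e′ m)
    }
  }

toSE : ∀ {k n} → Path k (vtx 0 n 0 z≤n) → SE k n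
toSE p = record { vertex = vertex p ; end = end p ; step = step p ; limit = limit p }

fromSE : ∀ {k n} → SE k n → Path k (vtx 0 n 0 z≤n)
fromSE p = record { vertex = SE.vertex p ; end = SE.end p ; step = SE.step p ; limit = SE.limit p }

straight : ∀ v → Path (Vertex.i v) v
straight v = record
  { vertex = ascent v
  ; end    = ≡.refl
  ; step   = λ m → climb-step (ascent v m)
  -- Each step raises the rank by one and a level has `i + 1` vertices per column, so `N * suc i`
  -- steps climb past `N` levels.
  ; limit  = λ N → N ℕ.* suc (Vertex.i v) , λ m N≤m → ascent-i v m ,
      rank⇒t (ascent v m) N (≡.subst₂ _≤_
        (≡.cong (λ i → N ℕ.* suc i) (≡.sym (ascent-i v m)))
        (≡.sym (rank-ascent v m))
        (ℕₚ.≤-trans N≤m (ℕₚ.m≤m+n m (rank v))))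
  }

cons : ∀ {k u v} → Step u v → Path k u → Path k v
cons {k} {u} {v} s p = record
  { vertex = λ { zero → v ; (suc m) → vertex p m }
  ; end    = ≡.refl
  ; step   = λ { zero → ≡.subst (λ x → Step x v) (≡.sym (end p)) s ; (suc m) → step p m }
  -- The bound grows by exactly one, so the weight of the new path has exactly one more factor;
  -- `weight-cons` relies on this.
  ; limit  = λ N → suc (proj₁ (limit p N)) , λ { (suc m) (s≤s M≤m) → proj₂ (limit p N) m M≤m }
  }

tail : ∀ {k v} (p : Path k v) → Path k (vertex p 1)
tail p = record
  { vertex = vertex p ∘ suc
  ; end    = ≡.refl
  ; step   = step p ∘ suc
  ; limit  = λ N → proj₁ (limit p N) ℕ.∸ 1 , λ m M≤m →
      proj₂ (limit p N) (suc m) (ℕₚ.≤-trans (ℕₚ.m≤n+m∸n _ 1) (s≤s M≤m))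
  }

head : ∀ {k v} (p : Path k v) → Step (vertex p 1) v
head p = ≡.subst (Step _) (end p) (step p 0)

cons-head-tail : ∀ {k v} (p : Path k v) m → vertex p m ≡ vertex (cons (head p) (tail p)) m
cons-head-tail p zero    = end p
cons-head-tail p (suc m) = ≡.refl

-- The column can only grow towards the end of the path, and it is `k` far enough back; index `m` is
-- compared with index `M + m`.
column-bound : ∀ {k v} (p : Path k v) m → k ≤ Vertex.i (vertex p m)
column-bound {k} p m = ≡.subst (_≤ _) (proj₁ (proj₂ (limit p 0) (M ℕ.+ m) (ℕₚ.m≤m+n M m))) (antitone M)
  where
  M = proj₁ (limit p 0)
  antitone : ∀ d → Vertex.i (vertex p (d ℕ.+ m)) ≤ Vertex.i (vertex p m)
  antitone zero    = ℕₚ.≤-refl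
  antitone (suc d) = ℕₚ.≤-trans (step-i (step p (d ℕ.+ m))) (antitone d)

-- When the end point already lies in the source column, `column-bound` leaves no room for an east
-- step, so every step is vertical.
straight-unique : ∀ v (p : Path (Vertex.i v) v) m → vertex p m ≡ ascent v m
straight-unique v p zero    = end p
straight-unique v p (suc m) = ≡.trans
  (vertical⇒climb (step p m) (ℕₚ.≤-antisym (step-i (step p m))
    (ℕₚ.≤-trans (ℕₚ.≤-reflexive in-column) (column-bound p (suc m)))))
  (≡.cong climb (straight-unique v p m))
  where
  in-column : Vertex.i (vertex p m) ≡ Vertex.i v
  in-column = ≡.trans (≡.cong Vertex.i (straight-unique v p m)) (ascent-i v m)

-- Weights of paths and their sums over slabs

module PathSums {c ℓ₁ ℓ₂ : Level} (K : HeytingField c ℓ₁ ℓ₂)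
                (w : Weights.WeightSystem K) where
  open HeytingField K
  open HeytingCommutativeRing heytingCommutativeRing using (commutativeRing)
  open CommutativeRing commutativeRing using (semiring; commutativeSemiring)
  open SemiringSum semiring
    using (sum-syntax; ∑-distrib-+; *-distribˡ-sum; sum-cong-≋; sum-replicate-zero)
  open NaturalSolver commutativeSemiring using (solve; _:=_; _:+_; _:*_)
  open Weights K
  open WeightSystem w

  prefixProduct : (ℕ → Carrier) → ℕ → Carrier
  prefixProduct x M = foldr _*_ 1# (map x (upTo M))

  prefixProduct-suc : ∀ x M → prefixProduct x (suc M) ≡ x 0 * prefixProduct (x ∘ suc) M
  prefixProduct-suc x M = ≡.cong (λ ys → x 0 * foldr _*_ 1# ys)
    (≡.trans (Listₚ.map-applyUpTo suc x M) (≡.sym (Listₚ.map-applyUpTo id (x ∘ suc) M)))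

  -- For `M = 0` both products are empty, and the hypothesis is itself the conclusion `1# ≈ 0#`.
  prefixProduct-tail≈0 : ∀ x M → prefixProduct (x ∘ suc) (M ℕ.∸ 1) ≈ 0# → prefixProduct x M ≈ 0#
  prefixProduct-tail≈0 x zero    1≈0 = 1≈0
  prefixProduct-tail≈0 x (suc M) ≈0 =
    trans (reflexive (prefixProduct-suc x M)) (trans (*-congˡ ≈0) (zeroʳ _))

  weightOf : ∀ {k v} → Path k v → Carrier
  weightOf p = prefixProduct (λ m → stepWeight w (step p m)) (proj₁ (limit p 0))

  weight-cons : ∀ {k u v} (s : Step u v) (p : Path k u) →
                weightOf (cons s p) ≈ stepWeight w s * weightOf p
  weight-cons {v = v} s p = trans
    (reflexive (prefixProduct-suc (λ m → stepWeight w (step (cons s p) m)) (proj₁ (limit p 0))))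
    (*-congʳ (reflexive (stepWeight-subst (≡.sym (end p)))))
    where
    stepWeight-subst : ∀ {x} (e : _ ≡ x) →
      stepWeight w (≡.subst (λ x → Step x v) e s) ≡ stepWeight w s
    stepWeight-subst ≡.refl = ≡.refl

  weight-tail≈0 : ∀ {k v} (p : Path k v) → weightOf (tail p) ≈ 0# → weightOf p ≈ 0#
  weight-tail≈0 p = prefixProduct-tail≈0 (λ m → stepWeight w (step p m)) (proj₁ (limit p 0))

  -- From level `height` upwards all east steps have weight zero, and a path ending there outside
  -- column `k` must take one of them to get out of column `k`.
  high-weight≈0 : ∀ {k v} (p : Path k v) → height ≤ Vertex.t v → Vertex.i v ≢ k → weightOf p ≈ 0#
  high-weight≈0 {k} {v} p high i≢k =
    go (vertex p) (step p) (proj₁ (limit p 0))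
      (≡.subst (λ v → height ≤ Vertex.t v) (≡.sym (end p)) high)
      (λ e → i≢k (≡.trans (≡.cong Vertex.i (≡.sym (end p))) e))
      (proj₁ (proj₂ (limit p 0) _ ℕₚ.≤-refl))
    where
    first : ∀ {u v} (s : Step u v) → height ≤ Vertex.t v → Vertex.i v ≢ k →
            stepWeight w s ≈ 0# ⊎ Vertex.i u ≢ k
    first (east {t} {i} {j} {p}) high i≢k = inj₁ (vanishes t i j high (recompute (j ℕₚ.≤? i) p))
    first south                  high i≢k = inj₂ i≢k
    first south′                 high i≢k = inj₂ i≢k

    -- Stated for a bare sequence of steps, so that the induction can pass to the shifted sequence
    -- `x ∘ suc`.
    go : (x : ℕ → Vertex) (s : ∀ m → Step (x (suc m)) (x m)) → ∀ M →
         height ≤ Vertex.t (x 0) → Vertex.i (x 0) ≢ k → Vertex.i (x M) ≡ k →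
         prefixProduct (λ m → stepWeight w (s m)) M ≈ 0#
    go x s zero    high i≢k e = contradiction e i≢k
    go x s (suc M) high i≢k e with first (s 0) high i≢k
    ... | inj₁ ≈0   = trans (reflexive (prefixProduct-suc (λ m → stepWeight w (s m)) M))
                        (trans (*-congʳ ≈0) (zeroˡ _))
    ... | inj₂ i≢k′ = trans (reflexive (prefixProduct-suc (λ m → stepWeight w (s m)) M))
                        (trans (*-congˡ (go (x ∘ suc) (s ∘ suc) M (ℕₚ.≤-trans high (step-t (s 0))) i≢k′ e))
                          (zeroʳ _))

  total : ∀ {k v} → List (Path k v) → Carrier
  total ps = foldr _+_ 0# (map weightOf ps)

  total-++ : ∀ {k v} (ps qs : List (Path k v)) → total (ps ++ qs) ≈ total ps + total qs
  total-++ []       qs = sym (+-identityˡ _)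
  total-++ (p ∷ ps) qs = trans (+-congˡ (total-++ ps qs)) (sym (+-assoc _ _ _))

  total-cons : ∀ {k u v} (s : Step u v) (ps : List (Path k u)) →
               total (map (cons s) ps) ≈ stepWeight w s * total ps
  total-cons s []       = sym (zeroʳ _)
  total-cons s (p ∷ ps) =
    trans (+-cong (weight-cons s p) (total-cons s ps)) (sym (distribˡ _ _ _))

  -- D(n,j) of the header, for x = w(t;_,_).
  slabSum : (ℕ → ℕ → Carrier) → (ℕ → Carrier) → ℕ → ℕ → Carrier
  slabSum x u zero    j = u j
  slabSum x u (suc n) j = slabSum x u n (suc j) + x (n ℕ.+ j) j * slabSum x u n j

  -- The sum over the paths ending in v^t_{i,0} obtained from sums u at level t + l.
  columnSum : ℕ → ℕ → (ℕ → Carrier) → ℕ → Carrier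
  columnSum zero    t u i = u i
  columnSum (suc l) t u i = slabSum (weight t) (columnSum l (suc t) u) i 0

  δ : ℕ → ℕ → Carrier
  δ k i with k ℕₚ.≟ i
  ... | yes _ = 1#
  ... | no  _ = 0#

  -- Only the values `u j, …, u (n + j)` enter. The bound in the hypothesis matters because the
  -- finite expansion of `u` in `columnSum-expand` agrees with `u` only up to a given index.
  slabSum-cong : ∀ x {u u′} n {j} → (∀ i → i ≤ n ℕ.+ j → u i ≈ u′ i) →
                 slabSum x u n j ≈ slabSum x u′ n j
  slabSum-cong x zero    u≈u′ = u≈u′ _ ℕₚ.≤-refl
  slabSum-cong x (suc n) u≈u′ = +-cong
    (slabSum-cong x n (λ i i≤ → u≈u′ i (ℕₚ.≤-trans i≤ (ℕₚ.≤-reflexive (ℕₚ.+-suc n _)))))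
    (*-congˡ (slabSum-cong x n (λ i i≤ → u≈u′ i (ℕₚ.m≤n⇒m≤1+n i≤))))

  columnSum-cong : ∀ l t {u u′} i → (∀ i′ → i′ ≤ i → u i′ ≈ u′ i′) →
                   columnSum l t u i ≈ columnSum l t u′ i
  columnSum-cong zero    t i u≈u′ = u≈u′ i ℕₚ.≤-refl
  columnSum-cong (suc l) t i u≈u′ = slabSum-cong (weight t) i λ i′ i′≤ →
    columnSum-cong l (suc t) i′ λ i″ i″≤ →
      u≈u′ i″ (ℕₚ.≤-trans i″≤ (ℕₚ.≤-trans i′≤ (ℕₚ.≤-reflexive (ℕₚ.+-identityʳ i))))

  slabSum-∑ : ∀ x {N} (a : Fin N → Carrier) (v : Fin N → ℕ → Carrier) n j →
              slabSum x (λ i → ∑[ k < N ] (a k * v k i)) n j ≈ ∑[ k < N ] (a k * slabSum x (v k) n j)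
  slabSum-∑ x a v zero    j = refl
  slabSum-∑ x a v (suc n) j = begin
    slabSum x (λ i → ∑[ k < _ ] (a k * v k i)) n (suc j) + xⱼ * slabSum x (λ i → ∑[ k < _ ] (a k * v k i)) n j
      ≈⟨ +-cong (slabSum-∑ x a v n (suc j)) (*-congˡ (slabSum-∑ x a v n j)) ⟩
    ∑[ k < _ ] (a k * slabSum x (v k) n (suc j)) + xⱼ * ∑[ k < _ ] (a k * slabSum x (v k) n j)
      ≈⟨ +-congˡ (*-distribˡ-sum xⱼ (λ k → a k * slabSum x (v k) n j)) ⟩
    ∑[ k < _ ] (a k * slabSum x (v k) n (suc j)) + ∑[ k < _ ] (xⱼ * (a k * slabSum x (v k) n j))
      ≈⟨ ∑-distrib-+ (λ k → a k * slabSum x (v k) n (suc j)) _ ⟨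
    ∑[ k < _ ] (a k * slabSum x (v k) n (suc j) + xⱼ * (a k * slabSum x (v k) n j))
      ≈⟨ sum-cong-≋ (λ k → solve 4 (λ a d x e → a :* d :+ x :* (a :* e) := a :* (d :+ x :* e)) refl
           (a k) (slabSum x (v k) n (suc j)) xⱼ (slabSum x (v k) n j)) ⟩
    ∑[ k < _ ] (a k * slabSum x (v k) (suc n) j) ∎
    where
    open SetoidReasoning setoid
    xⱼ : Carrier
    xⱼ = x (n ℕ.+ j) j

  columnSum-∑ : ∀ l t {N} (a : Fin N → Carrier) (v : Fin N → ℕ → Carrier) i →
                columnSum l t (λ i → ∑[ k < N ] (a k * v k i)) i ≈ ∑[ k < N ] (a k * columnSum l t (v k) i)
  columnSum-∑ zero    t a v i = refl
  columnSum-∑ (suc l) t a v i = trans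
    (slabSum-cong (weight t) i (λ i′ _ → columnSum-∑ l (suc t) a v i′))
    (slabSum-∑ (weight t) a (λ k → columnSum l (suc t) (v k)) i 0)

  δ-suc : ∀ k i → δ (suc k) (suc i) ≈ δ k i
  δ-suc k i with k ℕₚ.≟ i | suc k ℕₚ.≟ suc i
  ... | yes _   | yes _ = refl
  ... | yes k≡i | no  k≢i = contradiction (≡.cong suc k≡i) k≢i
  ... | no  k≢i | yes k≡i = contradiction (ℕₚ.suc-injective k≡i) k≢i
  ... | no  _   | no  _ = refl

  ∑-δ : ∀ u {N i} → i < N → ∑[ k < N ] (u (toℕ k) * δ (toℕ k) i) ≈ u i
  ∑-δ u {suc N} {zero}  _ = trans (+-cong (*-identityʳ _)
    (trans (sum-cong-≋ {N} (λ _ → zeroʳ _)) (sum-replicate-zero N))) (+-identityʳ _)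
  ∑-δ u {suc N} {suc i} (s≤s i<N) = trans (+-cong (zeroʳ _)
    (trans (sum-cong-≋ {N} (λ k → *-congˡ (δ-suc (toℕ k) i))) (∑-δ (u ∘ suc) i<N))) (+-identityˡ _)

  -- Linearity in the base values: the sums for arbitrary `u` are combinations of the sums for
  -- `δ k`, which are the actual path sums out of column `k`.
  columnSum-expand : ∀ l t u i →
    columnSum l t u i ≈ ∑[ k < suc i ] (u (toℕ k) * columnSum l t (δ (toℕ k)) i)
  columnSum-expand l t u i = trans
    (columnSum-cong l t i (λ i′ i′≤i → sym (∑-δ u (s≤s i′≤i))))
    (columnSum-∑ l t {suc i} (λ k → u (toℕ k)) (λ k → δ (toℕ k)) i)

  -- Enumeration of the paths that can have nonzero weight

  module _ (k : ℕ) where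

    above : ∀ {n j i} → n ℕ.+ j ≡ i → j ≤ i
    above {n} e = ℕₚ.m+n≤o⇒n≤o n (ℕₚ.≤-reflexive e)

    Covered : ∀ {v} → Path k v → List (Path k v) → Set ℓ₁
    Covered {v} p ps = Membership._∈_ (Path-setoid k v) p ps ⊎ weightOf p ≈ 0#

    module Slab (t : ℕ) (base : ∀ i → List (Path k (vtx (suc t) i 0 z≤n))) where

      southward : ∀ n j → Step (vtx t (suc n ℕ.+ j) (suc j) (above {n} (ℕₚ.+-suc n j)))
                               (vtx t (suc n ℕ.+ j) j (above {suc n} ≡.refl))
      southward n j = south

      eastward : ∀ n j → Step (vtx t (n ℕ.+ j) j (above {n} ≡.refl))
                              (vtx t (suc n ℕ.+ j) j (above {suc n} ≡.refl))
      eastward n j = east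

      -- For `n = 0` the end point is the topmost vertex of its column in the slab, reached only
      -- from `v^{t+1}_{j,0}`; otherwise it is reached from above or from the left. The column `i`
      -- is a separate index because `n + suc j` and `suc n + j` agree only propositionally.
      slab : ∀ n j i (e : n ℕ.+ j ≡ i) → List (Path k (vtx t i j (above {n} e)))
      slab zero    j .j             ≡.refl = map (cons south′) (base j)
      slab (suc n) j .(suc n ℕ.+ j) ≡.refl =
        map (cons (southward n j)) (slab n (suc j) _ (ℕₚ.+-suc n j)) ++
        map (cons (eastward n j)) (slab n j _ ≡.refl)

      total-slab : ∀ (u : ℕ → Carrier) → (∀ i → total (base i) ≈ u i) → ∀ n j i e →
                   total (slab n j i e) ≈ slabSum (weight t) u n j
      total-slab u base≈u zero    j .j             ≡.refl =
        trans (total-cons south′ (base j)) (trans (*-identityˡ _) (base≈u j))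
      total-slab u base≈u (suc n) j .(suc n ℕ.+ j) ≡.refl = trans
        (total-++ (map (cons (southward n j)) (slab n (suc j) _ (ℕₚ.+-suc n j)))
                  (map (cons (eastward n j)) (slab n j _ ≡.refl)))
        (+-cong
        (trans (total-cons (southward n j) (slab n (suc j) _ (ℕₚ.+-suc n j)))
          (trans (*-identityˡ _) (total-slab u base≈u n (suc j) _ (ℕₚ.+-suc n j))))
        (trans (total-cons (eastward n j) (slab n j _ ≡.refl))
          (*-congˡ (total-slab u base≈u n j _ ≡.refl))))

      module _ (covers : ∀ i (p : Path k (vtx (suc t) i 0 z≤n)) → Covered p (base i)) where

        cons-∈ : ∀ {u v} (s : Step u v) {p : Path k u} {ps} →
                 Membership._∈_ (Path-setoid k u) p ps →
                 Membership._∈_ (Path-setoid k v) (cons s p) (map (cons s) ps)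
        cons-∈ s = Membershipₚ.∈-map⁺ (Path-setoid k _) (Path-setoid k _)
          λ p≈q → λ { zero → ≡.refl ; (suc m) → p≈q m }

        -- Induction on `n` after splitting off the last step. In `slab-covers′` that step starts at
        -- a variable vertex, which permits matching on its constructor. The recomposed path has the
        -- vertices of `p`, which settles membership; vanishing passes from the tail to `p`.
        slab-covers : ∀ n j i e (p : Path k (vtx t i j (above {n} e))) → Covered p (slab n j i e)
        slab-covers′ : ∀ n j i e {u} (s : Step u (vtx t i j (above {n} e))) (p : Path k u) →
          Membership._∈_ (Path-setoid k (vtx t i j (above {n} e))) (cons s p) (slab n j i e)
            ⊎ weightOf p ≈ 0#

        slab-covers n j i e p = Sum.map
          (Membershipₚ.∈-resp-≈ (Path-setoid k (vtx t i j (above {n} e)))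
            {x = cons (head p) (tail p)} {y = p} (λ m → ≡.sym (cons-head-tail p m)))
          (weight-tail≈0 p)
          (slab-covers′ n j i e (head p) (tail p))

        -- For `n = 0`, that is `j = i`, an east step would start in a row above the top of its
        -- column; a south step within the level is excluded likewise below.
        slab-covers′ zero j i e (east {p = h}) p =
          ⊥-elim-irr (ℕₚ.<⇒≱ (ℕₚ.≤-reflexive (≡.sym e)) h)
        slab-covers′ (suc n) j i e east p with e
        ... | ≡.refl =
          Sum.map₁ (λ p∈ → Anyₚ.++⁺ʳ _ (cons-∈ (eastward n j) p∈))
            (slab-covers n j _ ≡.refl p)
        slab-covers′ zero j i e (south {p = h}) p =
          ⊥-elim-irr (ℕₚ.<⇒≱ h (ℕₚ.≤-reflexive (≡.sym e)))
        slab-covers′ (suc n) j i e south p with e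
        ... | ≡.refl =
          Sum.map₁ (λ p∈ → Anyₚ.++⁺ˡ (cons-∈ (southward n j) p∈))
            (slab-covers n (suc j) _ (ℕₚ.+-suc n j) p)
        slab-covers′ zero j .j ≡.refl south′ p =
          Sum.map₁ (cons-∈ south′) (covers j p)
        slab-covers′ (suc n) j .j e south′ p =
          contradiction (≡.sym e) (ℕₚ.m≢1+n+m j)

      module _ (unique : ∀ i → Unique.Unique (Path-setoid k _) (base i)) where

        cons-unique : ∀ {u v} (s : Step u v) {ps} → Unique.Unique (Path-setoid k u) ps →
                      Unique.Unique (Path-setoid k v) (map (cons s) ps)
        cons-unique {u} {v} s = Uniqueₚ.map⁺ (Path-setoid k u) (Path-setoid k v) {f = cons s}
          λ e m → e (suc m)

        vertex-cons-∈ : ∀ {u v} (s : Step u v) {p : Path k v} {ps} →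
                        Membership._∈_ (Path-setoid k v) p (map (cons s) ps) → vertex p 1 ≡ u
        vertex-cons-∈ {u} {v} s {p} p∈ =
          let q , _ , p≈ = Membershipₚ.∈-map⁻ (Path-setoid k u) (Path-setoid k v) {v = p} p∈
          in ≡.trans (p≈ 1) (end q)

        -- The two sublists are disjoint: their paths differ at position 1, where the columns are
        -- `suc n + j` and `n + j`.
        slab-unique : ∀ n j i e → Unique.Unique (Path-setoid k _) (slab n j i e)
        slab-unique zero    j .j             ≡.refl = cons-unique south′ (unique j)
        slab-unique (suc n) j .(suc n ℕ.+ j) ≡.refl = Uniqueₚ.++⁺
          (Path-setoid k (vtx t (suc n ℕ.+ j) j (above {suc n} ≡.refl)))
          (cons-unique (southward n j) (slab-unique n (suc j) _ (ℕₚ.+-suc n j)))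
          (cons-unique (eastward n j) (slab-unique n j _ ≡.refl))
          λ {p} (p∈south , p∈east) → contradiction
            (≡.cong Vertex.i (≡.trans
              (≡.sym (vertex-cons-∈ (southward n j) {p} p∈south))
              (vertex-cons-∈ (eastward n j) {p} p∈east)))
            ℕₚ.1+n≢n

    -- Here `l` counts the slabs still to be crossed. With none left, `t` is meant to be at least
    -- the height, where only the vertical path in column `k` has to be listed.
    columnPaths : ∀ (l t i : ℕ) → List (Path k (vtx t i 0 z≤n))
    columnPaths zero t i with k ℕₚ.≟ i
    ... | yes ≡.refl = straight (vtx t k 0 z≤n) ∷ []
    ... | no  _      = []
    columnPaths (suc l) t i = Slab.slab t (columnPaths l (suc t)) i 0 i (ℕₚ.+-identityʳ i)

    columnPaths-total : ∀ (l t i : ℕ) → total (columnPaths l t i) ≈ columnSum l t (δ k) i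
    columnPaths-total zero t i with k ℕₚ.≟ i
    -- The bound supplied by `straight` for `N = 0` is `0`, so the weight is the empty product.
    ... | yes ≡.refl = +-identityʳ 1#
    ... | no  _      = refl
    columnPaths-total (suc l) t i = Slab.total-slab t (columnPaths l (suc t))
      (columnSum l (suc t) (δ k)) (columnPaths-total l (suc t)) i 0 i (ℕₚ.+-identityʳ i)

    columnPaths-unique : ∀ (l t i : ℕ) → Unique.Unique (Path-setoid k (vtx t i 0 z≤n)) (columnPaths l t i)
    columnPaths-unique zero t i with k ℕₚ.≟ i
    ... | yes ≡.refl = All.[] AllPairs.∷ AllPairs.[]
    ... | no  _      = AllPairs.[]
    columnPaths-unique (suc l) t i = Slab.slab-unique t (columnPaths l (suc t))
      (columnPaths-unique l (suc t)) i 0 i (ℕₚ.+-identityʳ i)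

    columnPaths-covers : ∀ (l t : ℕ) → height ≤ l ℕ.+ t → ∀ i (p : Path k (vtx t i 0 z≤n)) →
                         Covered p (columnPaths l t i)
    columnPaths-covers zero t high i p with k ℕₚ.≟ i
    ... | yes ≡.refl = inj₁ (here (straight-unique (vtx t k 0 z≤n) p))
    ... | no  k≢i    = inj₂ (high-weight≈0 p high (k≢i ∘ ≡.sym))
    columnPaths-covers (suc l) t high i p = Slab.slab-covers t (columnPaths l (suc t))
      (columnPaths-covers l (suc t) (≡.subst (height ≤_) (≡.sym (ℕₚ.+-suc l t)) high))
      i 0 i (ℕₚ.+-identityʳ i) p

  columnSum-is-h : ∀ n k {s} → columnSum height 0 (δ k) n ≈ s → Is-h w n k s
  columnSum-is-h n k sum≈s =
    map toSE ps ,
    Uniqueₚ.map⁺ (Path-setoid k v) (SE-setoid k n) {f = toSE} id (columnPaths-unique k height 0 n) ,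
    (λ p → Sum.map₁
      (Membershipₚ.∈-map⁺ (Path-setoid k v) (SE-setoid k n) {f = toSE} id {v = fromSE p})
      (columnPaths-covers k height 0 (ℕₚ.m≤m+n height 0) n (fromSE p))) ,
    trans (reflexive (≡.cong (foldr _+_ 0#) (≡.sym (Listₚ.map-∘ {g = pathWeight w} {f = toSE} ps))))
      (trans (columnPaths-total k height 0 n) sum≈s)
    where
    v : Vertex
    v = vtx 0 n 0 z≤n
    ps : List (Path k v)
    ps = columnPaths k height 0 n

-- Coefficients of Laurent polynomials

module LaurentCoefficients {c ℓ₁ ℓ₂ : Level} (K : HeytingField c ℓ₁ ℓ₂) where
  open FieldOps K
  open LaurentPolynomials K
  open SemiringSum semiring using (sum; sum-syntax; sum-init-last; sum-cong-≗)

  ∑-snoc : ∀ N (f : ℕ → Carrier) → ∑[ k < suc N ] f (toℕ k) ≈ ∑[ k < N ] f (toℕ k) + f N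
  ∑-snoc N f = trans (sum-init-last {N} (f ∘ toℕ)) (reflexive (≡.cong₂ _+_
    (sum-cong-≗ {N} (λ k → ≡.cong f (Finₚ.toℕ-inject₁ k))) (≡.cong f (Finₚ.toℕ-fromℕ N))))

  coeff-⊕ : ∀ f g m → coeff (f ⊕ g) m ≈ coeff f m + coeff g m
  coeff-⊕ []            g m = sym (+-identityˡ _)
  coeff-⊕ ((e , a) ∷ f) g m with e ℤₚ.≟ m
  ... | yes _ = trans (+-congˡ (coeff-⊕ f g m)) (sym (+-assoc _ _ _))
  ... | no  _ = coeff-⊕ f g m

  coeff-map : ∀ e a g m →
    coeff (map (λ (e′ , a′) → (e ℤ.+ e′ , a * a′)) g) m ≈ a * coeff g (m ℤ.- e)
  coeff-map e a []              m = sym (zeroʳ a)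
  coeff-map e a ((e′ , a′) ∷ g) m with e ℤ.+ e′ ℤₚ.≟ m | e′ ℤₚ.≟ m ℤ.- e
  ... | yes _  | yes _  = trans (+-congˡ (coeff-map e a g m)) (sym (distribˡ a _ _))
  ... | yes e≡ | no  e≢ = contradiction
    (≡.trans (shift e e′) (≡.cong (ℤ._- e) e≡)) e≢
    where
    shift : ∀ e e′ → e′ ≡ e ℤ.+ e′ ℤ.- e
    shift = ℤ-Solver.solve-∀
  ... | no  e≢ | yes e≡ = contradiction
    (≡.trans (≡.cong (ℤ._+_ e) e≡) (shift e m)) e≢
    where
    shift : ∀ e m → e ℤ.+ (m ℤ.- e) ≡ m
    shift = ℤ-Solver.solve-∀
  ... | no  _  | no  _  = coeff-map e a g m

  coeff-∷-⊗ : ∀ e a f g m → coeff (((e , a) ∷ f) ⊗ g) m ≈ a * coeff g (m ℤ.- e) + coeff (f ⊗ g) m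
  coeff-∷-⊗ e a f g m = trans
    (coeff-⊕ (map (λ (e′ , a′) → (e ℤ.+ e′ , a * a′)) g) (f ⊗ g) m) (+-congʳ (coeff-map e a g m))

  coeff-monomial-⊗ : ∀ e a g m → coeff (monomial e a ⊗ g) m ≈ a * coeff g (m ℤ.- e)
  coeff-monomial-⊗ e a g m = trans (coeff-∷-⊗ e a [] g m) (+-identityʳ _)

  coeff-const-⊗ : ∀ a g m → coeff (const a ⊗ g) m ≈ a * coeff g m
  coeff-const-⊗ a g m = trans (coeff-monomial-⊗ 0ℤ a g m)
    (*-congˡ (reflexive (≡.cong (coeff g) (ℤₚ.+-identityʳ m))))

  coeff-monomial : ∀ e a m → coeff (monomial e a) m ≈ a * coeff (monomial e 1#) m
  coeff-monomial e a m with e ℤₚ.≟ m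
  ... | yes _ = trans (+-identityʳ a) (sym (trans (*-congˡ (+-identityʳ 1#)) (*-identityʳ a)))
  ... | no  _ = sym (zeroʳ a)

  coeff-sum≤ : ∀ n f m → coeff (sum≤ n f) m ≈ ∑[ k < suc n ] coeff (f (toℕ k)) m
  coeff-sum≤ n f m = trans
    (reflexive (≡.cong (λ fs → coeff (foldr _⊕_ [] fs) m) (Listₚ.map-applyUpTo id f (suc n))))
    (go f (suc n))
    where
    go : ∀ f n → coeff (foldr _⊕_ [] (applyUpTo f n)) m ≈ ∑[ k < n ] coeff (f (toℕ k)) m
    go f zero    = refl
    go f (suc n) = trans (coeff-⊕ (f 0) _ m) (+-congˡ (go (f ∘ suc) n))

-- The continuous q-Hermite polynomials and their mixed moments

module Hermite {c ℓ₁ ℓ₂ : Level} (K : HeytingField c ℓ₁ ℓ₂)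
               (q : HeytingField.Carrier K) (q-ind : FieldOps.Indeterminate K q) where
  open FieldOps K
  open QHermite K q q-ind
  open LaurentCoefficients K
  open CommutativeRing commutativeRing using (commutativeSemiring)
  open RingProperties ring using (-1*x≈-x; +-cancelʳ)
  open SemiringSum semiring
    using (sum-syntax; ∑-distrib-+; *-distribˡ-sum; sum-cong-≋; sum-replicate-zero)
  open NaturalSolver commutativeSemiring using (solve; _:=_; _:+_; _:*_; con)
  open SetoidReasoning setoid

  -- The semiring solver does not know negation, so signs are written as factors u.
  p u : Carrier
  p = recip q q#0
  u = - 1#

  1+u≈0 : 1# + u ≈ 0#
  1+u≈0 = -‿inverseʳ 1#

  -≈u* : ∀ x → - x ≈ u * x
  -≈u* x = sym (-1*x≈-x x)

  qp-cancel : ∀ x y → q * x * (p * y) ≈ x * y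
  qp-cancel x y = begin
    q * x * (p * y)    ≈⟨ solve 4 (λ q x p y → q :* x :* (p :* y) := p :* q :* (x :* y)) refl q x p y ⟩
    p * q * (x * y)    ≈⟨ *-congʳ (recip-inverseˡ q q#0) ⟩
    1# * (x * y)       ≈⟨ *-identityˡ _ ⟩
    x * y              ∎

  qⁿpⁿ≈1 : ∀ n → q ^ n * p ^ n ≈ 1#
  qⁿpⁿ≈1 zero    = *-identityˡ 1#
  qⁿpⁿ≈1 (suc n) = trans (qp-cancel (q ^ n) (p ^ n)) (qⁿpⁿ≈1 n)

  drop-1+u : ∀ x y → x + (1# + u) * y ≈ x
  drop-1+u x y = trans (+-congˡ (trans (*-congʳ 1+u≈0) (zeroˡ y))) (+-identityʳ x)

  q⁻ⁿ≡pⁿ : ∀ n → q^ (ℤ.- + n) ≡ p ^ n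
  q⁻ⁿ≡pⁿ zero    = ≡.refl
  q⁻ⁿ≡pⁿ (suc n) = ≡.refl

  λ′ : ℕ → Carrier
  λ′ n = ½ * ½ * (1# + u * q ^ n)

  -- This makes `pred 0 = 0` a harmless stand-in for the index -1: wherever `pred n` or `pred j`
  -- occurs below, the term carries a factor that vanishes at zero.
  λ′0≈0 : λ′ 0 ≈ 0#
  λ′0≈0 = trans (*-congˡ (trans (+-congˡ (*-identityʳ u)) 1+u≈0)) (zeroʳ _)

  -- Multiplication by `cosθ`, acting on coefficient functions; `≋` then becomes pointwise equality.
  X : (ℤ → Carrier) → ℤ → Carrier
  X f m = ½ * f (m ℤ.- 1ℤ) + ½ * f (m ℤ.- -1ℤ)

  X-cong : ∀ {f g} → (∀ m → f m ≈ g m) → ∀ m → X f m ≈ X g m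
  X-cong f≈g m = +-cong (*-congˡ (f≈g _)) (*-congˡ (f≈g _))

  X-linear : ∀ f a g m → X (λ m → f m + a * g m) m ≈ X f m + a * X g m
  X-linear f a g m = solve 6 (λ h f a g f′ g′ →
    h :* (f :+ a :* g) :+ h :* (f′ :+ a :* g′) := h :* f :+ h :* f′ :+ a :* (h :* g :+ h :* g′))
    refl ½ (f _) a (g _) (f _) (g _)

  coeff-cosθ-⊗ : ∀ g m → coeff (cosθ ⊗ g) m ≈ X (coeff g) m
  coeff-cosθ-⊗ g m = trans (coeff-∷-⊗ 1ℤ (½ * 1#) (monomial -1ℤ (½ * 1#)) g m) (+-cong (*-congʳ (*-identityʳ ½))
    (trans (coeff-monomial-⊗ -1ℤ (½ * 1#) g m) (*-congʳ (*-identityʳ ½))))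

  -- The q-binomial coefficients

  -- ∏_{i<k} (1 - q^{n-i}), written without truncated subtraction.
  P : ℕ → ℕ → Carrier
  P n zero    = 1#
  P n (suc k) = P n k * (1# + u * (q ^ n * p ^ k))

  -- Since `q^{n+1} p^{k+1} = q^n p^k`, all factors after the first are those of `P n k`.
  P-suc : ∀ n k → P (suc n) (suc k) ≈ (1# + u * q ^ suc n) * P n k
  P-suc n zero    = solve 2 (λ u a → con 1 :* (con 1 :+ u :* (a :* con 1)) := (con 1 :+ u :* a) :* con 1)
    refl u (q ^ suc n)
  P-suc n (suc k) = begin
    P (suc n) (suc k) * (1# + u * (q * q ^ n * (p * p ^ k)))
      ≈⟨ *-cong (P-suc n k) (+-congˡ (*-congˡ (qp-cancel (q ^ n) (p ^ k)))) ⟩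
    (1# + u * q ^ suc n) * P n k * (1# + u * (q ^ n * p ^ k))
      ≈⟨ *-assoc _ _ _ ⟩
    (1# + u * q ^ suc n) * P n (suc k) ∎

  P-zero : ∀ k → P 0 (suc k) ≈ 0#
  P-zero zero    = trans (*-identityˡ _) (trans (+-congˡ (trans (*-congˡ (*-identityˡ 1#)) (*-identityʳ u))) 1+u≈0)
  P-zero (suc k) = trans (*-congʳ (P-zero k)) (zeroˡ _)

  -- For `n = 0` both sides vanish, the right one through `1 - q^0`.
  P-pred : ∀ n k → P n (suc k) ≈ (1# + u * q ^ n) * P (pred n) k
  P-pred zero    k = trans (P-zero k)
    (sym (trans (*-congʳ (trans (+-congˡ (*-identityʳ u)) 1+u≈0)) (zeroˡ _)))
  P-pred (suc n) k = P-suc n k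

  r : ℕ → Carrier
  r k = recip (qPoch q k) (qPoch-q#0 k)

  r-suc : ∀ k → r k ≈ (1# + u * q ^ suc k) * r (suc k)
  r-suc k = begin
    r k                                            ≈⟨ *-identityʳ _ ⟨
    r k * 1#                                       ≈⟨ *-congˡ (recip-inverseˡ (qPoch q (suc k)) (qPoch-q#0 (suc k))) ⟨
    r k * (r (suc k) * (qPoch q k * (1# - q * q ^ k)))
      ≈⟨ solve 4 (λ a b c d → a :* (b :* (c :* d)) := a :* c :* (d :* b)) refl (r k) (r (suc k)) (qPoch q k) _ ⟩
    r k * qPoch q k * ((1# - q * q ^ k) * r (suc k))
      ≈⟨ *-cong (recip-inverseˡ (qPoch q k) (qPoch-q#0 k)) (*-congʳ (+-congˡ (-≈u* _))) ⟩
    1# * ((1# + u * q ^ suc k) * r (suc k))        ≈⟨ *-identityˡ _ ⟩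
    (1# + u * q ^ suc k) * r (suc k)               ∎

  -- The q-binomial coefficient [n choose k].
  b : ℕ → ℕ → Carrier
  b n k = P n k * r k

  -- The last factor of `P n (suc n)` is `1 - q^n p^n`. Sums over `k ≤ n` can thus be lengthened or
  -- shortened by one term.
  b-vanish : ∀ n → b n (suc n) ≈ 0#
  b-vanish n = trans (*-congʳ (trans (*-congˡ (trans (+-congˡ (trans (*-congˡ (qⁿpⁿ≈1 n)) (*-identityʳ u))) 1+u≈0)) (zeroʳ _))) (zeroˡ _)

  -- Combines the q-Pascal rule `[n+1,k+1] = [n,k+1] + q^{n-k} [n,k]` with
  -- `(1 - q^{n-k}) [n,k] = (1 - q^n) [n-1,k]`; every term is brought over the common factor
  -- `r (suc k)`.
  b-recurrence : ∀ n k → b n (suc k) + b n k ≈ b (suc n) (suc k) + (1# + u * q ^ n) * b (pred n) k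
  b-recurrence n k = begin
    B * ρ + P₀ * r k
      ≈⟨ +-congˡ (*-congˡ (r-suc k)) ⟩
    B * ρ + P₀ * ((1# + u * Q) * ρ)
      -- Inserts `-q^{n+1} P₀ ρ` together with its negative, as a multiple of `1 + u = 0`, since the
      -- semiring solver cannot subtract.
      ≈⟨ drop-1+u _ _ ⟨
    B * ρ + P₀ * ((1# + u * Q) * ρ) + (1# + u) * (u * (q * a) * (P₀ * ρ))
      ≈⟨ solve 6 (λ P B u Q y ρ → B :* ρ :+ P :* ((con 1 :+ u :* Q) :* ρ) :+ (con 1 :+ u) :* (u :* y :* (P :* ρ))
           := (con 1 :+ u :* y) :* P :* ρ :+ (B :* ρ :+ (u :* Q :* P :+ u :* u :* y :* P) :* ρ)) refl
           P₀ B u Q (q * a) ρ ⟩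
    (1# + u * (q * a)) * P₀ * ρ + (B * ρ + (u * Q * P₀ + u * u * (q * a) * P₀) * ρ)
      ≈⟨ +-congˡ (+-congˡ (*-congʳ (+-congˡ (*-congʳ (*-congˡ qa))))) ⟩
    (1# + u * (q * a)) * P₀ * ρ + (B * ρ + (u * Q * P₀ + u * u * (Q * (a * p ^ k)) * P₀) * ρ)
      ≈⟨ solve 6 (λ P u Q y z ρ → 
           (con 1 :+ u :* y) :* P :* ρ :+ (P :* (con 1 :+ u :* z) :* ρ :+ (u :* Q :* P :+ u :* u :* (Q :* z) :* P) :* ρ)
           := (con 1 :+ u :* y) :* P :* ρ :+ P :* (con 1 :+ u :* z) :* ((con 1 :+ u :* Q) :* ρ)) refl
           P₀ u Q (q * a) (a * p ^ k) ρ ⟩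
    (1# + u * (q * a)) * P₀ * ρ + B * ((1# + u * Q) * ρ)
      ≈⟨ +-cong (*-congʳ (sym (P-suc n k))) (*-cong (P-pred n k) (sym (r-suc k))) ⟩
    b (suc n) (suc k) + (1# + u * a) * P (pred n) k * r k
      ≈⟨ +-congˡ (*-assoc _ _ _) ⟩
    b (suc n) (suc k) + (1# + u * q ^ n) * b (pred n) k ∎
    where
    a P₀ B Q ρ : Carrier
    a  = q ^ n
    P₀ = P n k
    B  = P n (suc k)
    Q  = q ^ suc k
    ρ  = r (suc k)
    qa : q * a ≈ Q * (a * p ^ k)
    qa = begin
      q * a                      ≈⟨ *-identityʳ _ ⟨
      q * a * 1#                 ≈⟨ *-congˡ (qⁿpⁿ≈1 k) ⟨
      q * a * (q ^ k * p ^ k)    ≈⟨ solve 4 (λ q a x y → q :* a :* (x :* y) := q :* x :* (a :* y)) refl q a (q ^ k) (p ^ k) ⟩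
      Q * (a * p ^ k)            ∎

  -- Coefficients of H_n and the three-term recurrence

  -- Follows the recursion by which `_^ᴸ_` adds exponents, so that `monomial-^` holds by
  -- computation.
  -2·_ : ℕ → ℤ
  -2· zero  = 0ℤ
  -2· suc k = -[1+ 1 ] ℤ.+ (-2· k)

  -- The indicator of x = -2k.
  E : ℕ → ℤ → Carrier
  E k = coeff (monomial (-2· k) 1#)

  E-shift : ∀ k x → E k (x ℤ.+ + 2) ≈ E (suc k) x
  E-shift k x with (-2· k) ℤₚ.≟ x ℤ.+ + 2 | (-2· suc k) ℤₚ.≟ x
  ... | yes _ | yes _ = refl
  ... | no  _ | no  _ = refl
  ... | yes e | no ¬e = contradiction (≡.trans (≡.cong (ℤ._+_ -[1+ 1 ]) e) (shift x)) ¬e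
    where
    shift : ∀ x → -[1+ 1 ] ℤ.+ (x ℤ.+ + 2) ≡ x
    shift = ℤ-Solver.solve-∀
  ... | no ¬e | yes e = contradiction (≡.trans (shift (-2· k)) (≡.cong (ℤ._+ + 2) e)) ¬e
    where
    shift : ∀ y → y ≡ -[1+ 1 ] ℤ.+ y ℤ.+ + 2
    shift = ℤ-Solver.solve-∀

  -2·-suc-negative : ∀ k → -2· suc k ≡ -[1+ suc (k ℕ.+ k) ]
  -2·-suc-negative zero    = ≡.refl
  -2·-suc-negative (suc k) = ≡.trans (≡.cong (ℤ._+_ -[1+ 1 ]) (-2·-suc-negative k))
    (≡.cong (λ n → -[1+ suc (suc n) ]) (≡.sym (ℕₚ.+-suc k k)))

  E-suc : ∀ k n → E (suc k) (+ n) ≈ 0#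
  E-suc k n with (-2· suc k) ℤₚ.≟ + n
  ... | no  _ = refl
  ... | yes e with ≡.trans (≡.sym (-2·-suc-negative k)) e
  ...   | ()

  E-positive : ∀ k n → E k (+ suc n) ≈ 0#
  E-positive zero    n = refl
  E-positive (suc k) n = E-suc k (suc n)

  qPoch-0 : ∀ k → qPoch 0# k ≈ 1#
  qPoch-0 zero    = refl
  qPoch-0 (suc k) = begin
    qPoch 0# k * (1# - 0# * q ^ k)  ≈⟨ *-cong (qPoch-0 k) (+-congˡ (trans (-‿cong (zeroˡ _)) (trans (-≈u* 0#) (zeroʳ u)))) ⟩
    1# * (1# + 0#)                  ≈⟨ trans (*-identityˡ _) (+-identityʳ 1#) ⟩
    1#                              ∎

  φ-norm : ℕ → Carrier
  φ-norm k = u ^ k * q ^ (k C 2)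

  -- Factor by factor, `(1 - q^{k-n}) q^n = (1 - q^{n-k}) (-q^k)`, and the powers `q^0, …, q^{k-1}`
  -- multiply to `q ^ (k C 2)`. The form `q ^ n * 1#` is the coefficient produced by the argument of
  -- `φ` in `H`.
  qPoch-P : ∀ n k → qPoch (p ^ n) k * (q ^ n * 1#) ^ k ≈ P n k * φ-norm k
  qPoch-P n zero    = *-congˡ (sym (*-identityˡ 1#))
  qPoch-P n (suc k) = begin
    qPoch (p ^ n) k * (1# - p ^ n * q ^ k) * (q ^ n * 1# * (q ^ n * 1#) ^ k)
      ≈⟨ *-congʳ (*-congˡ (+-congˡ (-≈u* _))) ⟩
    qPoch (p ^ n) k * (1# + u * (p ^ n * q ^ k)) * (q ^ n * 1# * (q ^ n * 1#) ^ k)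
      ≈⟨ solve 6 (λ x u b c a y → x :* (con 1 :+ u :* (b :* c)) :* (a :* con 1 :* y)
           := x :* y :* (a :+ u :* c :* (a :* b))) refl (qPoch (p ^ n) k) u (p ^ n) (q ^ k) (q ^ n) ((q ^ n * 1#) ^ k) ⟩
    qPoch (p ^ n) k * (q ^ n * 1#) ^ k * (q ^ n + u * q ^ k * (q ^ n * p ^ n))
      ≈⟨ *-cong (qPoch-P n k) (+-congˡ (trans (*-congˡ (qⁿpⁿ≈1 n)) (*-identityʳ _))) ⟩
    P n k * φ-norm k * (q ^ n + u * q ^ k)
      ≈⟨ *-congˡ factor ⟩
    P n k * φ-norm k * ((1# + u * (q ^ n * p ^ k)) * (u * q ^ k))
      ≈⟨ solve 6 (λ P v c f u a → P :* (v :* c) :* (f :* (u :* a)) := P :* f :* (u :* v :* (a :* c)))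
           refl (P n k) (u ^ k) (q ^ (k C 2)) _ u (q ^ k) ⟩
    P n (suc k) * (u * u ^ k * (q ^ k * q ^ (k C 2)))
      ≈⟨ *-congˡ (*-congˡ (trans (sym (^-+ k (k C 2))) (reflexive (≡.cong (q ^_) C-suc)))) ⟩
    P n (suc k) * φ-norm (suc k) ∎
    where
    C-suc : k ℕ.+ k C 2 ≡ suc k C 2
    C-suc = ≡.trans (≡.cong (ℕ._+ k C 2) (≡.sym (Combinatorics.nC1≡n k))) (Combinatorics.nCk+nC[k+1]≡[n+1]C[k+1] k 1)
    ^-+ : ∀ i j → q ^ (i ℕ.+ j) ≈ q ^ i * q ^ j
    ^-+ zero    j = sym (*-identityˡ _)
    ^-+ (suc i) j = trans (*-congˡ (^-+ i j)) (sym (*-assoc _ _ _))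
    factor : q ^ n + u * q ^ k ≈ (1# + u * (q ^ n * p ^ k)) * (u * q ^ k)
    factor = begin
      q ^ n + u * q ^ k
        ≈⟨ +-congʳ (drop-1+u _ (u * q ^ n)) ⟨
      q ^ n + (1# + u) * (u * q ^ n) + u * q ^ k
        ≈⟨ solve 3 (λ a u c → a :+ (con 1 :+ u) :* (u :* a) :+ u :* c
             := a :+ u :* a :+ u :* u :* a :+ u :* c) refl (q ^ n) u (q ^ k) ⟩
      q ^ n + u * q ^ n + u * u * q ^ n + u * q ^ k
        ≈⟨ +-congʳ (+-congʳ (solve 2 (λ a u → a :+ u :* a := con 0 :+ (con 1 :+ u) :* a) refl (q ^ n) u)) ⟩
      0# + (1# + u) * q ^ n + u * u * q ^ n + u * q ^ k
        ≈⟨ +-congʳ (+-congʳ (drop-1+u 0# _)) ⟩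
      0# + u * u * q ^ n + u * q ^ k
        ≈⟨ +-congʳ (+-congˡ (trans (sym (*-identityʳ _)) (*-congˡ (sym (qⁿpⁿ≈1 k))))) ⟩
      0# + u * u * q ^ n * (q ^ k * p ^ k) + u * q ^ k
        ≈⟨ solve 4 (λ a u c d → con 0 :+ u :* u :* a :* (c :* d) :+ u :* c
             := (con 1 :+ u :* (a :* d)) :* (u :* c)) refl (q ^ n) u (q ^ k) (p ^ k) ⟩
      (1# + u * (q ^ n * p ^ k)) * (u * q ^ k) ∎

  -- The sign and power of `q` from `qPoch-P` cancel against the denominator in `φ-coeff`, and
  -- `(0;q)_k = 1`.
  φ-coeff-b : ∀ n k → φ-coeff (q^ (ℤ.- + n)) 0# k * (q ^ n * 1#) ^ k ≈ b n k
  φ-coeff-b n k = begin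
    qPoch (q^ (ℤ.- + n)) k * qPoch 0# k * r k * ρ * A
      ≈⟨ *-congʳ (*-congʳ (*-congʳ (*-cong (reflexive (≡.cong (λ x → qPoch x k) (q⁻ⁿ≡pⁿ n))) (qPoch-0 k)))) ⟩
    qPoch (p ^ n) k * 1# * r k * ρ * A
      ≈⟨ solve 4 (λ x r ρ A → x :* con 1 :* r :* ρ :* A := x :* A :* (r :* ρ)) refl (qPoch (p ^ n) k) (r k) ρ A ⟩
    qPoch (p ^ n) k * A * (r k * ρ)
      ≈⟨ *-congʳ (qPoch-P n k) ⟩
    P n k * φ-norm k * (r k * ρ)
      ≈⟨ solve 4 (λ x v r ρ → x :* v :* (r :* ρ) := x :* r :* (ρ :* v)) refl (P n k) (φ-norm k) (r k) ρ ⟩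
    b n k * (ρ * φ-norm k)
      ≈⟨ *-congˡ (recip-inverseˡ (φ-norm k) _) ⟩
    b n k * 1#
      ≈⟨ *-identityʳ _ ⟩
    b n k ∎
    where
    A ρ : Carrier
    A = (q ^ n * 1#) ^ k
    ρ = recip (φ-norm k) (x#0y#0→xy#0 (^-#0 -1#0 k) (^-#0 q#0 (k C 2)))

  monomial-^ : ∀ a k → monomial (ℤ.- + 2) a ^ᴸ k ≡ monomial (-2· k) (a ^ k)
  monomial-^ a zero    = ≡.refl
  monomial-^ a (suc k) = ≡.cong (monomial (ℤ.- + 2) a ⊗_) (monomial-^ a k)

  coeff-H : ∀ n m → coeff (H n) m ≈ ½ ^ n * ∑[ k < suc n ] (b n (toℕ k) * E (toℕ k) (m ℤ.- + n))
  coeff-H n m = begin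
    coeff (H n) m
      ≈⟨ coeff-monomial-⊗ (+ n) (½ ^ n * 1#) (φ n 0# z) m ⟩
    ½ ^ n * 1# * coeff (φ n 0# z) x
      ≈⟨ *-cong (*-identityʳ _) (coeff-sum≤ n (λ k → const (φ-coeff (q^ (ℤ.- + n)) 0# k) ⊗ z ^ᴸ k) x) ⟩
    ½ ^ n * ∑[ k < suc n ] coeff (const (φ-coeff (q^ (ℤ.- + n)) 0# (toℕ k)) ⊗ z ^ᴸ toℕ k) x
      ≈⟨ *-congˡ (sum-cong-≋ {suc n} (λ k → term (toℕ k))) ⟩
    ½ ^ n * ∑[ k < suc n ] (b n (toℕ k) * E (toℕ k) x) ∎
    where
    z : Laurent
    z = const (q ^ n) ⊗ e^i (ℤ.- + 2) θ
    x : ℤ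
    x = m ℤ.- + n
    term : ∀ k → coeff (const (φ-coeff (q^ (ℤ.- + n)) 0# k) ⊗ z ^ᴸ k) x ≈ b n k * E k x
    term k = begin
      coeff (const (φ-coeff (q^ (ℤ.- + n)) 0# k) ⊗ z ^ᴸ k) x
        ≈⟨ coeff-const-⊗ _ (z ^ᴸ k) x ⟩
      φ-coeff (q^ (ℤ.- + n)) 0# k * coeff (z ^ᴸ k) x
        ≈⟨ *-congˡ (reflexive (≡.cong (λ f → coeff f x) (monomial-^ (q ^ n * 1#) k))) ⟩
      φ-coeff (q^ (ℤ.- + n)) 0# k * coeff (monomial (-2· k) ((q ^ n * 1#) ^ k)) x
        ≈⟨ *-congˡ (coeff-monomial (-2· k) _ x) ⟩
      φ-coeff (q^ (ℤ.- + n)) 0# k * ((q ^ n * 1#) ^ k * E k x)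
        ≈⟨ *-assoc _ _ _ ⟨
      φ-coeff (q^ (ℤ.- + n)) 0# k * (q ^ n * 1#) ^ k * E k x
        ≈⟨ *-congʳ (φ-coeff-b n k) ⟩
      b n k * E k x ∎

  -- The exponents in `H n` are `n - 2k ≤ n`. With `H-lead` this gives the triangularity behind
  -- `H-independent`.
  H-degree : ∀ {n d} → n < d → coeff (H n) (+ d) ≈ 0#
  H-degree {n} {d} n<d = begin
    coeff (H n) (+ d)
      ≈⟨ coeff-H n (+ d) ⟩
    ½ ^ n * ∑[ k < suc n ] (b n (toℕ k) * E (toℕ k) (+ d ℤ.- + n))
      ≈⟨ *-congˡ (sum-cong-≋ {suc n} (λ k → trans (*-congˡ (E≈0 (toℕ k))) (zeroʳ (b n (toℕ k))))) ⟩
    ½ ^ n * ∑[ k < suc n ] 0#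
      ≈⟨ *-congˡ (sum-replicate-zero (suc n)) ⟩
    ½ ^ n * 0#
      ≈⟨ zeroʳ _ ⟩
    0# ∎
    where
    E≈0 : ∀ k → E k (+ d ℤ.- + n) ≈ 0#
    E≈0 k = trans (reflexive (≡.cong (E k) (≡.trans (ℤₚ.m-n≡m⊖n d n)
        (≡.trans (ℤₚ.⊖-≥ (ℕₚ.<⇒≤ n<d)) (≡.cong (λ k → + k) (ℕₚ.+-∸-assoc 1 n<d))))))
      (E-positive k (d ℕ.∸ suc n))

  r0≈1 : r 0 ≈ 1#
  r0≈1 = trans (sym (*-identityʳ _)) (recip-inverseˡ 1# (qPoch-q#0 0))

  b0≈1 : ∀ n → b n 0 ≈ 1#
  b0≈1 n = trans (*-identityˡ _) r0≈1

  H-lead : ∀ n → coeff (H n) (+ n) ≈ ½ ^ n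
  H-lead n = begin
    coeff (H n) (+ n)
      ≈⟨ coeff-H n (+ n) ⟩
    ½ ^ n * ∑[ k < suc n ] (b n (toℕ k) * E (toℕ k) (+ n ℤ.- + n))
      ≈⟨ *-congˡ (reflexive (≡.cong (λ x → ∑[ k < suc n ] (b n (toℕ k) * E (toℕ k) x)) (ℤₚ.+-inverseʳ (+ n)))) ⟩
    ½ ^ n * (b n 0 * (1# + 0#) + ∑[ k < n ] (b n (suc (toℕ k)) * E (suc (toℕ k)) 0ℤ))
      ≈⟨ *-congˡ (+-cong (*-cong (b0≈1 n) (+-identityʳ 1#))
           (trans (sum-cong-≋ {n} (λ k → trans (*-congˡ (E-suc (toℕ k) 0)) (zeroʳ _))) (sum-replicate-zero n))) ⟩
    ½ ^ n * (1# * 1# + 0#)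
      ≈⟨ trans (*-congˡ (trans (+-identityʳ _) (*-identityˡ 1#))) (*-identityʳ _) ⟩
    ½ ^ n ∎

  -- With b the q-binomial coefficients, 2ⁿ H_n = ∑_k b(n,k) e^{𝐢(n-2k)θ}, and the
  -- claim is `b-recurrence`, read off at y = m - n - 1.
  H-recurrence : ∀ n m → X (coeff (H n)) m ≈ coeff (H (suc n)) m + λ′ n * coeff (H (pred n)) m
  H-recurrence n m = begin
    X (coeff (H n)) m
      ≈⟨ +-cong (*-congˡ (coeff-H n _)) (*-congˡ (coeff-H n _)) ⟩
    ½ * (½ ^ n * ∑[ k < suc n ] (b n (toℕ k) * E (toℕ k) (m ℤ.- 1ℤ ℤ.- + n)))
      + ½ * (½ ^ n * ∑[ k < suc n ] (b n (toℕ k) * E (toℕ k) (m ℤ.- -1ℤ ℤ.- + n)))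
      ≈⟨ +-cong (*-congˡ (*-congˡ lower)) (*-congˡ (*-congˡ upper)) ⟩
    ½ * (½ ^ n * (b₀ + S₁)) + ½ * (½ ^ n * S₂)
      ≈⟨ solve 5 (λ h x b s t → h :* (x :* (b :+ s)) :+ h :* (x :* t) := h :* x :* (b :+ (s :+ t)))
           refl ½ (½ ^ n) b₀ S₁ S₂ ⟩
    ½ ^ suc n * (b₀ + (S₁ + S₂))
      ≈⟨ *-congˡ (+-congˡ combine) ⟩
    ½ ^ suc n * (b₀ + (S₃ + (1# + u * q ^ n) * S₄))
      ≈⟨ solve 6 (λ h x b s c t → h :* x :* (b :+ (s :+ c :* t)) := h :* x :* (b :+ s) :+ h :* x :* (c :* t))
           refl ½ (½ ^ n) b₀ S₃ (1# + u * q ^ n) S₄ ⟩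
    ½ ^ suc n * (b₀ + S₃) + ½ ^ suc n * ((1# + u * q ^ n) * S₄)
      ≈⟨ +-cong next (previous n) ⟩
    coeff (H (suc n)) m + λ′ n * coeff (H (pred n)) m ∎
    where
    y : ℤ
    y = m ℤ.- 1ℤ ℤ.- + n
    b₀ S₁ S₂ S₃ S₄ : Carrier
    b₀ = b n 0 * E 0 y
    S₁ = ∑[ k < suc n ] (b n (suc (toℕ k)) * E (suc (toℕ k)) y)
    S₂ = ∑[ k < suc n ] (b n (toℕ k) * E (suc (toℕ k)) y)
    S₃ = ∑[ k < suc n ] (b (suc n) (suc (toℕ k)) * E (suc (toℕ k)) y)
    S₄ = ∑[ k < suc n ] (b (pred n) (toℕ k) * E (suc (toℕ k)) y)

    lower : ∑[ k < suc n ] (b n (toℕ k) * E (toℕ k) y) ≈ b₀ + S₁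
    lower = begin
      ∑[ k < suc n ] (b n (toℕ k) * E (toℕ k) y)
        ≈⟨ +-identityʳ _ ⟨
      ∑[ k < suc n ] (b n (toℕ k) * E (toℕ k) y) + 0#
        -- The vanishing term `k = n + 1` is appended, so that splitting off `k = 0` leaves exactly
        -- the `n + 1` terms of `S₁`.
        ≈⟨ +-congˡ (trans (*-congʳ (b-vanish n)) (zeroˡ _)) ⟨
      ∑[ k < suc n ] (b n (toℕ k) * E (toℕ k) y) + b n (suc n) * E (suc n) y
        ≈⟨ ∑-snoc (suc n) (λ k → b n k * E k y) ⟨
      b₀ + S₁ ∎

    upper : ∑[ k < suc n ] (b n (toℕ k) * E (toℕ k) (m ℤ.- -1ℤ ℤ.- + n)) ≈ S₂
    upper = sum-cong-≋ {suc n} (λ k → *-congˡ {b n (toℕ k)} (trans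
      (reflexive (≡.cong (E (toℕ k)) (shift m (+ n)))) (E-shift (toℕ k) y)))
      where
      shift : ∀ m n → m ℤ.- -1ℤ ℤ.- n ≡ m ℤ.- 1ℤ ℤ.- n ℤ.+ + 2
      shift = ℤ-Solver.solve-∀

    combine : S₁ + S₂ ≈ S₃ + (1# + u * q ^ n) * S₄
    combine = begin
      S₁ + S₂
        ≈⟨ ∑-distrib-+ {suc n} (λ k → b n (suc (toℕ k)) * E (suc (toℕ k)) y)
             (λ k → b n (toℕ k) * E (suc (toℕ k)) y) ⟨
      ∑[ k < suc n ] (b n (suc (toℕ k)) * E (suc (toℕ k)) y + b n (toℕ k) * E (suc (toℕ k)) y)
        ≈⟨ sum-cong-≋ {suc n} (λ k → trans (sym (distribʳ (E (suc (toℕ k)) y) (b n (suc (toℕ k))) (b n (toℕ k))))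
             (trans (*-congʳ {E (suc (toℕ k)) y} (b-recurrence n (toℕ k)))
               (trans (distribʳ _ _ _) (+-congˡ (*-assoc _ _ _))))) ⟩
      ∑[ k < suc n ] (b (suc n) (suc (toℕ k)) * E (suc (toℕ k)) y
                        + (1# + u * q ^ n) * (b (pred n) (toℕ k) * E (suc (toℕ k)) y))
        ≈⟨ ∑-distrib-+ {suc n} (λ k → b (suc n) (suc (toℕ k)) * E (suc (toℕ k)) y)
             (λ k → (1# + u * q ^ n) * (b (pred n) (toℕ k) * E (suc (toℕ k)) y)) ⟩
      S₃ + ∑[ k < suc n ] ((1# + u * q ^ n) * (b (pred n) (toℕ k) * E (suc (toℕ k)) y))
        ≈⟨ +-congˡ (*-distribˡ-sum {suc n} (1# + u * q ^ n) (λ k → b (pred n) (toℕ k) * E (suc (toℕ k)) y)) ⟨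
      S₃ + (1# + u * q ^ n) * S₄ ∎

    next : ½ ^ suc n * (b₀ + S₃) ≈ coeff (H (suc n)) m
    next = begin
      ½ ^ suc n * (b₀ + S₃)
        ≈⟨ *-congˡ (+-congʳ (*-congʳ (trans (b0≈1 n) (sym (b0≈1 (suc n)))))) ⟩
      ½ ^ suc n * ∑[ k < suc (suc n) ] (b (suc n) (toℕ k) * E (toℕ k) y)
        ≈⟨ *-congˡ (reflexive (≡.cong (λ x → ∑[ k < suc (suc n) ] (b (suc n) (toℕ k) * E (toℕ k) x)) (shift m (+ n)))) ⟩
      ½ ^ suc n * ∑[ k < suc (suc n) ] (b (suc n) (toℕ k) * E (toℕ k) (m ℤ.- + suc n))
        ≈⟨ coeff-H (suc n) m ⟨
      coeff (H (suc n)) m ∎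
      where
      shift : ∀ m n → m ℤ.- 1ℤ ℤ.- n ≡ m ℤ.- (1ℤ ℤ.+ n)
      shift = ℤ-Solver.solve-∀

    -- Quantified over its own `n`, as the case split decides `pred n`: for zero the factor
    -- `1 - q^0` vanishes, otherwise the top term of the sum does, by `b-vanish`.
    previous : ∀ n → ½ ^ suc n * ((1# + u * q ^ n)
                 * ∑[ k < suc n ] (b (pred n) (toℕ k) * E (suc (toℕ k)) (m ℤ.- 1ℤ ℤ.- + n)))
                 ≈ λ′ n * coeff (H (pred n)) m
    previous zero = trans
      (*-congˡ (trans (*-congʳ (trans (+-congˡ (*-identityʳ u)) 1+u≈0)) (zeroˡ _)))
      (trans (zeroʳ _) (sym (trans (*-congʳ λ′0≈0) (zeroˡ _))))
    previous (suc n) = begin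
      ½ ^ suc (suc n) * (w * ∑[ k < suc (suc n) ] (b n (toℕ k) * E (suc (toℕ k)) y′))
        ≈⟨ *-congˡ (*-congˡ (∑-snoc (suc n) (λ k → b n k * E (suc k) y′))) ⟩
      ½ ^ suc (suc n) * (w * (∑[ k < suc n ] (b n (toℕ k) * E (suc (toℕ k)) y′) + b n (suc n) * E (suc (suc n)) y′))
        ≈⟨ *-congˡ (*-congˡ (trans (+-congˡ (trans (*-congʳ (b-vanish n)) (zeroˡ _))) (+-identityʳ _))) ⟩
      ½ ^ suc (suc n) * (w * ∑[ k < suc n ] (b n (toℕ k) * E (suc (toℕ k)) y′))
        ≈⟨ *-congˡ (*-congˡ (sum-cong-≋ {suc n} (λ k → *-congˡ {b n (toℕ k)} (trans (sym (E-shift (toℕ k) y′))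
             (reflexive (≡.cong (E (toℕ k)) (shift m (+ n)))))))) ⟩
      ½ ^ suc (suc n) * (w * ∑[ k < suc n ] (b n (toℕ k) * E (toℕ k) (m ℤ.- + n)))
        ≈⟨ solve 4 (λ h x w s → h :* (h :* x) :* (w :* s) := h :* h :* w :* (x :* s)) refl ½ (½ ^ n) w _ ⟩
      λ′ (suc n) * (½ ^ n * ∑[ k < suc n ] (b n (toℕ k) * E (toℕ k) (m ℤ.- + n)))
        ≈⟨ *-congˡ (coeff-H n m) ⟨
      λ′ (suc n) * coeff (H n) m ∎
      where
      w : Carrier
      w = 1# + u * q ^ suc n
      y′ : ℤ
      y′ = m ℤ.- 1ℤ ℤ.- + suc n
      shift : ∀ m n → m ℤ.- 1ℤ ℤ.- (1ℤ ℤ.+ n) ℤ.+ + 2 ≡ m ℤ.- n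
      shift = ℤ-Solver.solve-∀

  -- Slab sums with base values H_i

  open PathSums K wᴴ-system

  -- With `i = n + j`, the weight depends only on `j` for `t = 0` and only on `n` for `t = 1, 2`. In
  -- the latter slabs the recursion therefore has the same coefficient in every row, which the
  -- inductions below exploit.
  wᴴ₀ : ∀ n j → wᴴ 0 (n ℕ.+ j) j ≈ (q ^ j + p ^ j) * ½
  wᴴ₀ n j = *-congʳ (+-congˡ (reflexive (q⁻ⁿ≡pⁿ j)))

  wᴴ₁ : ∀ n j → wᴴ 1 (n ℕ.+ j) j ≈ u * ½ * p ^ n
  wᴴ₁ n j = begin
    - (q^ (+ j ℤ.- + (n ℕ.+ j))) * ½
      ≈⟨ *-congʳ (trans (-≈u* _) (*-congˡ (reflexive (≡.trans (≡.cong q^_ (shift (+ n) (+ j))) (q⁻ⁿ≡pⁿ n))))) ⟩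
    u * p ^ n * ½
      ≈⟨ solve 3 (λ u x h → u :* x :* h := u :* h :* x) refl u (p ^ n) ½ ⟩
    u * ½ * p ^ n ∎
    where
    shift : ∀ n j → j ℤ.- (n ℤ.+ j) ≡ ℤ.- n
    shift = ℤ-Solver.solve-∀

  wᴴ₂ : ∀ n j → wᴴ 2 (n ℕ.+ j) j ≈ u * ½ * q ^ n
  wᴴ₂ n j = begin
    - (q^ (+ (n ℕ.+ j) ℤ.- + j)) * ½
      ≈⟨ *-congʳ (trans (-≈u* _) (*-congˡ (reflexive (≡.cong q^_ (shift (+ n) (+ j)))))) ⟩
    u * q ^ n * ½
      ≈⟨ solve 3 (λ u x h → u :* x :* h := u :* h :* x) refl u (q ^ n) ½ ⟩
    u * ½ * q ^ n ∎
    where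
    shift : ∀ n j → (n ℤ.+ j) ℤ.- j ≡ n
    shift = ℤ-Solver.solve-∀

  -- `D₂`, `D₁`, `D₀` of the header, coefficient by coefficient; `m` is the exponent of `e^{𝐢θ}`.
  level₂ level₁ level₀ : ℕ → ℕ → ℤ → Carrier
  level₂ n j m = slabSum (wᴴ 2) (λ i → coeff (H i) m) n j
  level₁ n j m = slabSum (wᴴ 1) (λ i → level₂ i 0 m) n j
  level₀ n j m = slabSum (wᴴ 0) (λ i → level₁ i 0 m) n j

  level₂-suc : ∀ n j m → level₂ (suc n) j m ≈ level₂ n (suc j) m + u * ½ * q ^ n * level₂ n j m
  level₂-suc n j m = +-congˡ (*-congʳ (wᴴ₂ n j))

  level₁-suc : ∀ n j m → level₁ (suc n) j m ≈ level₁ n (suc j) m + u * ½ * p ^ n * level₁ n j m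
  level₁-suc n j m = +-congˡ (*-congʳ (wᴴ₁ n j))

  -- Absorbs the `λ_j D(n,j-1)` terms into row `j - 1` of the next `D`: for `j > 0` this is the
  -- recursion there, and for `j = 0` every term contains `λ′ 0`.
  λ′-pred : ∀ a (f g : ℕ → Carrier) → (∀ j → g j ≈ f (suc j) + a * f j) → ∀ j →
            λ′ j * f j + a * (λ′ j * f (pred j)) ≈ λ′ j * g (pred j)
  λ′-pred a f g g≈ zero    = begin
    λ′ 0 * f 0 + a * (λ′ 0 * f 0)  ≈⟨ +-cong (*-congʳ λ′0≈0) (*-congˡ (*-congʳ λ′0≈0)) ⟩
    0# * f 0 + a * (0# * f 0)      ≈⟨ solve 3 (λ a x y → con 0 :* x :+ a :* (con 0 :* x) := con 0 :* y) refl a (f 0) (g 0) ⟩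
    0# * g 0                       ≈⟨ *-congʳ λ′0≈0 ⟨
    λ′ 0 * g 0                     ∎
  λ′-pred a f g g≈ (suc j) = begin
    λ′ (suc j) * f (suc j) + a * (λ′ (suc j) * f j)
      ≈⟨ solve 4 (λ l x a y → l :* x :+ a :* (l :* y) := l :* (x :+ a :* y)) refl (λ′ (suc j)) (f (suc j)) a (f j) ⟩
    λ′ (suc j) * (f (suc j) + a * f j)
      ≈⟨ *-congˡ (g≈ j) ⟨
    λ′ (suc j) * g j ∎

  -- For `n > 0`, the recursion of `level₂` at `n - 1` multiplied by `q λ_n`; the extra `q` turns
  -- `q^{n-1}` into the `q^n` of the weight.
  λ′-level₂ : ∀ n j m → q * (λ′ n * level₂ (pred n) (suc j) m) + u * ½ * q ^ n * (λ′ n * level₂ (pred n) j m)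
                          ≈ q * λ′ n * level₂ n j m
  λ′-level₂ zero j m = begin
    q * (λ′ 0 * a) + v * (λ′ 0 * b′)  ≈⟨ +-cong (*-congˡ (*-congʳ λ′0≈0)) (*-congˡ (*-congʳ λ′0≈0)) ⟩
    q * (0# * a) + v * (0# * b′)      ≈⟨ solve 4 (λ q a v b → q :* (con 0 :* a) :+ v :* (con 0 :* b) := q :* con 0 :* b) refl q a v b′ ⟩
    q * 0# * b′                     ≈⟨ *-congʳ (*-congˡ λ′0≈0) ⟨
    q * λ′ 0 * b′                   ∎
    where
    a b′ v : Carrier
    a  = level₂ 0 (suc j) m
    b′ = level₂ 0 j m
    v  = u * ½ * q ^ 0
  λ′-level₂ (suc n) j m = begin
    q * (l * a) + u * ½ * (q * q ^ n) * (l * b′)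
      ≈⟨ solve 7 (λ q l a u h x b → q :* (l :* a) :+ u :* h :* (q :* x) :* (l :* b)
           := q :* l :* (a :+ u :* h :* x :* b)) refl q l a u ½ (q ^ n) b′ ⟩
    q * l * (a + u * ½ * q ^ n * b′)
      ≈⟨ *-congˡ (level₂-suc n j m) ⟨
    q * l * level₂ (suc n) j m ∎
    where
    a b′ l : Carrier
    a  = level₂ n (suc j) m
    b′ = level₂ n j m
    l  = λ′ (suc n)

  -- Both sides are (1 - q^{n+j+1})/4.
  λ′-+ : ∀ n j → λ′ (suc j) + q ^ j * (q * λ′ n) ≈ λ′ j + q ^ j * λ′ (suc n)
  λ′-+ n j = begin
    λ′ (suc j) + q ^ j * (q * λ′ n)
      ≈⟨ solve 5 (λ h u q a b →
           h :* h :* (con 1 :+ u :* (q :* b)) :+ b :* (q :* (h :* h :* (con 1 :+ u :* a)))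
           := h :* h :* (con 1 :+ b :* (u :* (q :* a))) :+ (con 1 :+ u) :* (h :* h :* q :* b)) refl
           ½ u q (q ^ n) (q ^ j) ⟩
    ½ * ½ * (1# + q ^ j * (u * (q * q ^ n))) + (1# + u) * (½ * ½ * q * q ^ j)
      ≈⟨ trans (drop-1+u _ _) (sym (drop-1+u _ _)) ⟩
    ½ * ½ * (1# + q ^ j * (u * (q * q ^ n))) + (1# + u) * (½ * ½ * q ^ j)
      ≈⟨ solve 5 (λ h u q a b →
           h :* h :* (con 1 :+ b :* (u :* (q :* a))) :+ (con 1 :+ u) :* (h :* h :* b)
           := h :* h :* (con 1 :+ u :* b) :+ b :* (h :* h :* (con 1 :+ u :* (q :* a)))) refl
           ½ u q (q ^ n) (q ^ j) ⟩
    λ′ j + q ^ j * λ′ (suc n) ∎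

  -- The base case is the three-term recurrence. In the step, the hypotheses for rows `j + 1` and
  -- `j` regroup by the recursion of `level₂`; the coefficients of `g₀` match by `λ′-+`.
  X-level₂ : ∀ n j m → X (level₂ n j) m ≈
    level₂ n (suc j) m + λ′ j * level₂ n (pred j) m + q ^ j * (λ′ n * level₂ (pred n) j m)
  X-level₂ zero j m = trans (H-recurrence j m)
    (sym (trans (+-congˡ (trans (*-congˡ (trans (*-congʳ λ′0≈0) (zeroˡ _))) (zeroʳ _))) (+-identityʳ _)))
  X-level₂ (suc n) j m = begin
    X (level₂ (suc n) j) m
      ≈⟨ X-cong (level₂-suc n j) m ⟩
    X (λ m → level₂ n (suc j) m + v * level₂ n j m) m
      ≈⟨ X-linear (level₂ n (suc j)) v (level₂ n j) m ⟩
    X (level₂ n (suc j)) m + v * X (level₂ n j) m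
      ≈⟨ +-cong (X-level₂ n (suc j) m) (*-congˡ (X-level₂ n j m)) ⟩
    g₂ + λ′ (suc j) * g₀ + q * q ^ j * (λ′ n * h₁) + v * (g₁ + λ′ j * gₚ + q ^ j * (λ′ n * h₀))
      ≈⟨ solve 7 (λ g₂ l k v g₁ l′ k′ →
           g₂ :+ l :+ k :+ v :* (g₁ :+ l′ :+ k′) := g₂ :+ v :* g₁ :+ v :* l′ :+ (l :+ (k :+ v :* k′))) refl
           g₂ (λ′ (suc j) * g₀) (q * q ^ j * (λ′ n * h₁)) v g₁ (λ′ j * gₚ) (q ^ j * (λ′ n * h₀)) ⟩
    g₂ + v * g₁ + v * (λ′ j * gₚ) + (λ′ (suc j) * g₀ + (q * q ^ j * (λ′ n * h₁) + v * (q ^ j * (λ′ n * h₀))))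
      ≈⟨ +-congˡ (+-congˡ (solve 5 (λ q a k v k′ → q :* a :* k :+ v :* (a :* k′) := a :* (q :* k :+ v :* k′)) refl
           q (q ^ j) (λ′ n * h₁) v (λ′ n * h₀))) ⟩
    g₂ + v * g₁ + v * (λ′ j * gₚ) + (λ′ (suc j) * g₀ + q ^ j * (q * (λ′ n * h₁) + v * (λ′ n * h₀)))
      ≈⟨ +-congˡ (+-congˡ (*-congˡ (λ′-level₂ n j m))) ⟩
    g₂ + v * g₁ + v * (λ′ j * gₚ) + (λ′ (suc j) * g₀ + q ^ j * (q * λ′ n * g₀))
      ≈⟨ +-congˡ (solve 4 (λ l g a k → l :* g :+ a :* (k :* g) := (l :+ a :* k) :* g) refl
           (λ′ (suc j)) g₀ (q ^ j) (q * λ′ n)) ⟩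
    g₂ + v * g₁ + v * (λ′ j * gₚ) + (λ′ (suc j) + q ^ j * (q * λ′ n)) * g₀
      ≈⟨ +-congˡ (*-congʳ (λ′-+ n j)) ⟩
    g₂ + v * g₁ + v * (λ′ j * gₚ) + (λ′ j + q ^ j * λ′ (suc n)) * g₀
      ≈⟨ solve 6 (λ a d l x k g → a :+ d :+ (l :+ x :* k) :* g := a :+ (l :* g :+ d) :+ x :* (k :* g)) refl
           (g₂ + v * g₁) (v * (λ′ j * gₚ)) (λ′ j) (q ^ j) (λ′ (suc n)) g₀ ⟩
    g₂ + v * g₁ + (λ′ j * g₀ + v * (λ′ j * gₚ)) + q ^ j * (λ′ (suc n) * g₀)
      ≈⟨ +-congʳ (+-cong (sym (level₂-suc n (suc j) m))
           (λ′-pred v (λ j → level₂ n j m) (λ j → level₂ (suc n) j m) (λ j → level₂-suc n j m) j)) ⟩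
    level₂ (suc n) (suc j) m + λ′ j * level₂ (suc n) (pred j) m + q ^ j * (λ′ (suc n) * level₂ n j m) ∎
    where
    v g₀ g₁ g₂ gₚ h₀ h₁ : Carrier
    v  = u * ½ * q ^ n
    g₀ = level₂ n j m
    g₁ = level₂ n (suc j) m
    g₂ = level₂ n (suc (suc j)) m
    gₚ = level₂ n (pred j) m
    h₀ = level₂ (pred n) j m
    h₁ = level₂ (pred n) (suc j) m

  -- The base case is `X-level₂ j 0`, where `n` and `j` exchange roles, with `level₂ j 1` expressed
  -- through `level₂ (suc j) 0`; this creates the diagonal term `½ q^j`.
  X-level₁ : ∀ n j m → X (level₁ n j) m ≈
    level₁ n (suc j) m + ½ * q ^ n * q ^ j * level₁ n j m + λ′ j * level₁ n (pred j) m
  X-level₁ zero j m = begin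
    X (level₂ j 0) m
      ≈⟨ X-level₂ j 0 m ⟩
    g₁ + λ′ 0 * g₀ + 1# * (λ′ j * gₚ)
      ≈⟨ +-cong (trans (+-congˡ (trans (*-congʳ λ′0≈0) (zeroˡ _))) (+-identityʳ _)) (*-identityˡ _) ⟩
    g₁ + λ′ j * gₚ
      ≈⟨ +-congʳ (drop-1+u _ _) ⟨
    g₁ + (1# + u) * (½ * q ^ j * g₀) + λ′ j * gₚ
      ≈⟨ solve 6 (λ g u h a g₀ y → g :+ (con 1 :+ u) :* (h :* a :* g₀) :+ y
           := g :+ u :* h :* a :* g₀ :+ h :* con 1 :* a :* g₀ :+ y) refl
           g₁ u ½ (q ^ j) g₀ (λ′ j * gₚ) ⟩
    g₁ + u * ½ * q ^ j * g₀ + ½ * 1# * q ^ j * g₀ + λ′ j * gₚ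
      ≈⟨ +-congʳ (+-congʳ (level₂-suc j 0 m)) ⟨
    level₂ (suc j) 0 m + ½ * 1# * q ^ j * g₀ + λ′ j * gₚ ∎
    where
    g₀ g₁ gₚ : Carrier
    g₀ = level₂ j 0 m
    g₁ = level₂ j 1 m
    gₚ = level₂ (pred j) 0 m
  X-level₁ (suc n) j m = begin
    X (level₁ (suc n) j) m
      ≈⟨ X-cong (level₁-suc n j) m ⟩
    X (λ m → level₁ n (suc j) m + v * level₁ n j m) m
      ≈⟨ X-linear (level₁ n (suc j)) v (level₁ n j) m ⟩
    X (level₁ n (suc j)) m + v * X (level₁ n j) m
      ≈⟨ +-cong (X-level₁ n (suc j) m) (*-congˡ (X-level₁ n j m)) ⟩
    g₂ + ½ * a * (q * c′) * g₁ + λ′ (suc j) * g₀ + v * (g₁ + ½ * a * c′ * g₀ + λ′ j * gₚ)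
      ≈⟨ solve 7 (λ g₂ k l v g₁ k′ l′ →
           g₂ :+ k :+ l :+ v :* (g₁ :+ k′ :+ l′) := g₂ :+ v :* g₁ :+ k :+ v :* l′ :+ (l :+ v :* k′)) refl
           g₂ (½ * a * (q * c′) * g₁) (λ′ (suc j) * g₀) v g₁ (½ * a * c′ * g₀) (λ′ j * gₚ) ⟩
    g₂ + v * g₁ + ½ * a * (q * c′) * g₁ + v * (λ′ j * gₚ) + (λ′ (suc j) * g₀ + v * (½ * a * c′ * g₀))
      ≈⟨ +-cong
           (+-congʳ (+-congˡ (*-congʳ (solve 4 (λ h a q c → h :* a :* (q :* c) := h :* (q :* a) :* c) refl ½ a q c′))))
           (solve 6 (λ l g₀ v h a c → l :* g₀ :+ v :* (h :* a :* c :* g₀) := (l :+ h :* c :* (a :* v)) :* g₀) refl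
             (λ′ (suc j)) g₀ v ½ a c′) ⟩
    g₂ + v * g₁ + ½ * (q * a) * c′ * g₁ + v * (λ′ j * gₚ) + (λ′ (suc j) + ½ * c′ * (a * v)) * g₀
      ≈⟨ +-congˡ (*-congʳ exchange) ⟩
    g₂ + v * g₁ + ½ * (q * a) * c′ * g₁ + v * (λ′ j * gₚ) + (λ′ j + ½ * q * c′ * (a * v)) * g₀
      ≈⟨ +-congˡ (solve 7 (λ l h q c a v g → (l :+ h :* q :* c :* (a :* v)) :* g
           := h :* (q :* a) :* c :* (v :* g) :+ l :* g) refl (λ′ j) ½ q c′ a v g₀) ⟩
    g₂ + v * g₁ + ½ * (q * a) * c′ * g₁ + v * (λ′ j * gₚ) + (½ * (q * a) * c′ * (v * g₀) + λ′ j * g₀)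
      ≈⟨ solve 6 (λ s k x y z l → s :+ k :* x :+ y :+ (k :* z :+ l) := s :+ k :* (x :+ z) :+ (l :+ y)) refl
           (g₂ + v * g₁) (½ * (q * a) * c′) g₁ (v * (λ′ j * gₚ)) (v * g₀) (λ′ j * g₀) ⟩
    g₂ + v * g₁ + ½ * (q * a) * c′ * (g₁ + v * g₀) + (λ′ j * g₀ + v * (λ′ j * gₚ))
      ≈⟨ +-cong (+-cong (sym (level₁-suc n (suc j) m)) (*-congˡ (sym (level₁-suc n j m))))
           (λ′-pred v (λ j → level₁ n j m) (λ j → level₁ (suc n) j m) (λ j → level₁-suc n j m) j) ⟩
    level₁ (suc n) (suc j) m + ½ * (q * a) * c′ * level₁ (suc n) j m + λ′ j * level₁ (suc n) (pred j) m ∎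
    where
    v a c′ g₀ g₁ g₂ gₚ : Carrier
    v  = u * ½ * p ^ n
    a  = q ^ n
    c′ = q ^ j
    g₀ = level₁ n j m
    g₁ = level₁ n (suc j) m
    g₂ = level₁ n (suc (suc j)) m
    gₚ = level₁ n (pred j) m
    av : a * v ≈ u * ½
    av = begin
      a * (u * ½ * p ^ n)    ≈⟨ solve 4 (λ a u h b → a :* (u :* h :* b) := u :* h :* (a :* b)) refl a u ½ (p ^ n) ⟩
      u * ½ * (a * p ^ n)    ≈⟨ *-congˡ (qⁿpⁿ≈1 n) ⟩
      u * ½ * 1#             ≈⟨ *-identityʳ _ ⟩
      u * ½                  ∎
    -- As `q^n v = -1/2`, both sides are `(1 - q^j - q^{j+1})/4`.
    exchange : λ′ (suc j) + ½ * c′ * (a * v) ≈ λ′ j + ½ * q * c′ * (a * v)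
    exchange = begin
      λ′ (suc j) + ½ * c′ * (a * v)   ≈⟨ +-congˡ (*-congˡ av) ⟩
      λ′ (suc j) + ½ * c′ * (u * ½)
        ≈⟨ solve 4 (λ h u q c → h :* h :* (con 1 :+ u :* (q :* c)) :+ h :* c :* (u :* h)
             := h :* h :* (con 1 :+ u :* c) :+ h :* q :* c :* (u :* h)) refl ½ u q c′ ⟩
      λ′ j + ½ * q * c′ * (u * ½)     ≈⟨ +-congˡ (*-congˡ av) ⟨
      λ′ j + ½ * q * c′ * (a * v)     ∎

  -- In the base case `½ q^j` comes from `X-level₁ j 0` and `½ p^j` from replacing `level₁ j 1` by
  -- `level₁ (suc j) 0`. Their sum is the weight in row `j`, so the inductive step is mere
  -- regrouping.
  X-level₀ : ∀ n j m → X (level₀ n j) m ≈ level₀ n (suc j) m + (q ^ j + p ^ j) * ½ * level₀ n j m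
  X-level₀ zero j m = begin
    X (level₁ j 0) m
      ≈⟨ X-level₁ j 0 m ⟩
    g₁ + ½ * q ^ j * 1# * g₀ + λ′ 0 * g₀
      ≈⟨ trans (+-congˡ (trans (*-congʳ λ′0≈0) (zeroˡ _))) (+-identityʳ _) ⟩
    g₁ + ½ * q ^ j * 1# * g₀
      ≈⟨ drop-1+u _ _ ⟨
    g₁ + ½ * q ^ j * 1# * g₀ + (1# + u) * (½ * p ^ j * g₀)
      ≈⟨ solve 6 (λ g h a g₀ u b → g :+ h :* a :* con 1 :* g₀ :+ (con 1 :+ u) :* (h :* b :* g₀)
           := g :+ u :* h :* b :* g₀ :+ (a :+ b) :* h :* g₀) refl g₁ ½ (q ^ j) g₀ u (p ^ j) ⟩
    g₁ + u * ½ * p ^ j * g₀ + (q ^ j + p ^ j) * ½ * g₀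
      ≈⟨ +-congʳ (level₁-suc j 0 m) ⟨
    level₁ (suc j) 0 m + (q ^ j + p ^ j) * ½ * g₀ ∎
    where
    g₀ g₁ : Carrier
    g₀ = level₁ j 0 m
    g₁ = level₁ j 1 m
  X-level₀ (suc n) j m = begin
    X (level₀ (suc n) j) m
      ≈⟨ X-linear (level₀ n (suc j)) v (level₀ n j) m ⟩
    X (level₀ n (suc j)) m + v * X (level₀ n j) m
      ≈⟨ +-cong (X-level₀ n (suc j) m) (*-congˡ (X-level₀ n j m)) ⟩
    g₂ + xⱼ₊₁ * g₁ + v * (g₁ + xⱼ * g₀)
      ≈⟨ +-cong (+-congˡ (*-congʳ (sym (wᴴ₀ n (suc j))))) (*-congʳ (wᴴ₀ n j)) ⟩
    level₀ (suc n) (suc j) m + xⱼ * (g₁ + xⱼ * g₀)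
      ≈⟨ +-congˡ (*-congˡ (+-congˡ (*-congʳ (wᴴ₀ n j)))) ⟨
    level₀ (suc n) (suc j) m + xⱼ * level₀ (suc n) j m ∎
    where
    v xⱼ xⱼ₊₁ g₀ g₁ g₂ : Carrier
    v = wᴴ 0 (n ℕ.+ j) j
    xⱼ = (q ^ j + p ^ j) * ½
    xⱼ₊₁ = (q ^ suc j + p ^ suc j) * ½
    g₀ = level₀ n j m
    g₁ = level₀ n (suc j) m
    g₂ = level₀ n (suc (suc j)) m

  cosθ^-level₀ : ∀ n m → coeff (cosθ ^ᴸ n) m ≈ level₀ n 0 m
  cosθ^-level₀ zero m = sym (begin
    coeff (H 0) m
      ≈⟨ coeff-H 0 m ⟩
    1# * (b 0 0 * E 0 (m ℤ.- 0ℤ) + 0#)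
      ≈⟨ trans (*-identityˡ _) (+-identityʳ _) ⟩
    b 0 0 * E 0 (m ℤ.- 0ℤ)
      ≈⟨ trans (*-congʳ (b0≈1 0)) (*-identityˡ _) ⟩
    E 0 (m ℤ.- 0ℤ)
      ≈⟨ reflexive (≡.cong (E 0) (ℤₚ.+-identityʳ m)) ⟩
    coeff (const 1#) m ∎)
  cosθ^-level₀ (suc n) m = begin
    coeff (cosθ ⊗ cosθ ^ᴸ n) m
      ≈⟨ coeff-cosθ-⊗ (cosθ ^ᴸ n) m ⟩
    X (coeff (cosθ ^ᴸ n)) m
      ≈⟨ X-cong (cosθ^-level₀ n) m ⟩
    X (level₀ n 0) m
      ≈⟨ X-level₀ n 0 m ⟩
    level₀ n 1 m + (1# + 1#) * ½ * level₀ n 0 m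
      ≈⟨ +-congˡ (*-congʳ (wᴴ₀ n 0)) ⟨
    level₀ (suc n) 0 m ∎

  -- The path sums as mixed moments

  pathSum : ℕ → ℕ → Carrier
  pathSum n k = columnSum 3 0 (δ k) n

  coeff-sum≤-const : ∀ (a : ℕ → Carrier) n m →
    coeff (sum≤ n (λ k → const (a k) ⊗ H k)) m ≈ ∑[ k < suc n ] (a (toℕ k) * coeff (H (toℕ k)) m)
  coeff-sum≤-const a n m = trans (coeff-sum≤ n (λ k → const (a k) ⊗ H k) m)
    (sum-cong-≋ {suc n} (λ k → coeff-const-⊗ (a (toℕ k)) (H (toℕ k)) m))

  pathSum-mixedMoments : IsMixedMoments pathSum
  pathSum-mixedMoments n m = begin
    coeff (cosθ ^ᴸ n) m
      ≈⟨ cosθ^-level₀ n m ⟩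
    -- This is `level₀ n 0 m` by definition. For fixed `m` the base values are scalars, so the
    -- expansion over `δ` applies.
    columnSum 3 0 (λ i → coeff (H i) m) n
      ≈⟨ columnSum-expand 3 0 (λ i → coeff (H i) m) n ⟩
    ∑[ k < suc n ] (coeff (H (toℕ k)) m * pathSum n (toℕ k))
      ≈⟨ sum-cong-≋ {suc n} (λ k → *-comm (coeff (H (toℕ k)) m) (pathSum n (toℕ k))) ⟩
    ∑[ k < suc n ] (pathSum n (toℕ k) * coeff (H (toℕ k)) m)
      ≈⟨ coeff-sum≤-const (pathSum n) n m ⟨
    coeff (sum≤ n (λ k → const (pathSum n k) ⊗ H k)) m ∎

  -- Linear independence of the H_k and uniqueness of the moments

  ½^-cancelʳ : ∀ n {x y} → x * ½ ^ n ≈ y * ½ ^ n → x ≈ y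
  ½^-cancelʳ zero    {x} {y} e = trans (sym (*-identityʳ x)) (trans e (*-identityʳ y))
  ½^-cancelʳ (suc n) {x} {y} e = ½^-cancelʳ n (trans (sym (double x)) (trans (*-congʳ e) (double y)))
    where
    double : ∀ x → x * ½ ^ suc n * (1# + 1#) ≈ x * ½ ^ n
    double x = begin
      x * (½ * ½ ^ n) * (1# + 1#)    ≈⟨ solve 4 (λ x h y t → x :* (h :* y) :* t := x :* y :* (h :* t)) refl x ½ (½ ^ n) (1# + 1#) ⟩
      x * ½ ^ n * (½ * (1# + 1#))    ≈⟨ *-congˡ (recip-inverseˡ (1# + 1#) 2#0) ⟩
      x * ½ ^ n * 1#                 ≈⟨ *-identityʳ _ ⟩
      x * ½ ^ n                      ∎

  H-sum : (ℕ → Carrier) → ℕ → ℤ → Carrier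
  H-sum a N m = ∑[ k < N ] (a (toℕ k) * coeff (H (toℕ k)) m)

  -- The monomial `e^{𝐢Nθ}` does not occur in `H k` for `k < N`, so it isolates the top coefficient.
  H-sum-top : ∀ a N → H-sum a (suc N) (+ N) ≈ a N * ½ ^ N
  H-sum-top a N = begin
    H-sum a (suc N) (+ N)
      ≈⟨ ∑-snoc N (λ k → a k * coeff (H k) (+ N)) ⟩
    H-sum a N (+ N) + a N * coeff (H N) (+ N)
      ≈⟨ +-cong (trans (sum-cong-≋ {N} (λ k → trans (*-congˡ (H-degree (Finₚ.toℕ<n k))) (zeroʳ (a (toℕ k)))))
           (sum-replicate-zero N)) (*-congˡ (H-lead N)) ⟩
    0# + a N * ½ ^ N
      ≈⟨ +-identityˡ _ ⟩
    a N * ½ ^ N ∎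

  H-top-unique : ∀ N a a′ → (∀ m → H-sum a (suc N) m ≈ H-sum a′ (suc N) m) → a N ≈ a′ N
  H-top-unique N a a′ e = ½^-cancelʳ N (begin
    a N * ½ ^ N             ≈⟨ H-sum-top a N ⟨
    H-sum a (suc N) (+ N)   ≈⟨ e (+ N) ⟩
    H-sum a′ (suc N) (+ N)  ≈⟨ H-sum-top a′ N ⟩
    a′ N * ½ ^ N            ∎)

  H-sum-lower : ∀ N a a′ → (∀ m → H-sum a (suc N) m ≈ H-sum a′ (suc N) m) →
                ∀ m → H-sum a N m ≈ H-sum a′ N m
  H-sum-lower N a a′ e m = +-cancelʳ (a N * coeff (H N) m) (H-sum a N m) (H-sum a′ N m) (begin
    H-sum a N m + a N * coeff (H N) m      ≈⟨ ∑-snoc N (λ k → a k * coeff (H k) m) ⟨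
    H-sum a (suc N) m                      ≈⟨ e m ⟩
    H-sum a′ (suc N) m                     ≈⟨ ∑-snoc N (λ k → a′ k * coeff (H k) m) ⟩
    H-sum a′ N m + a′ N * coeff (H N) m    ≈⟨ +-congˡ (*-congʳ (H-top-unique N a a′ e)) ⟨
    H-sum a′ N m + a N * coeff (H N) m     ∎)

  H-Independent : ℕ → Set (c ⊔ ℓ₁)
  H-Independent N = ∀ a a′ → (∀ m → H-sum a N m ≈ H-sum a′ N m) → ∀ {k} → k < N → a k ≈ a′ k

  -- The top coefficients agree first; cancelling their terms leaves equal shorter sums.
  H-independent-suc : ∀ N → H-Independent N → H-Independent (suc N)
  H-independent-suc N ind a a′ e (s≤s k≤N) = Sum.[
      ind a a′ (H-sum-lower N a a′ e)
    , (λ k≡N → ≡.subst (λ k → a k ≈ a′ k) (≡.sym k≡N) (H-top-unique N a a′ e))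
    ]′ (ℕₚ.m≤n⇒m<n∨m≡n k≤N)

  H-independent : ∀ N → H-Independent N
  H-independent zero    a a′ e ()
  H-independent (suc N) = H-independent-suc N (H-independent N)

  -- Carries the result from `pathSum` to an arbitrary `σ` with the defining expansion.
  mixedMoments-unique : ∀ {σ σ′} → IsMixedMoments σ → IsMixedMoments σ′ →
                        ∀ {n k} → k ≤ n → σ n k ≈ σ′ n k
  mixedMoments-unique {σ} {σ′} mm mm′ {n} k≤n = H-independent (suc n) (σ n) (σ′ n)
    (λ m → trans (sym (coeff-sum≤-const (σ n) n m))
      (trans (sym (mm n m)) (trans (mm′ n m) (coeff-sum≤-const (σ′ n) n m))))
    (s≤s k≤n)

proposition5p6 : ∀ {c ℓ₁ ℓ₂} (K : HeytingField c ℓ₁ ℓ₂) (q : HeytingField.Carrier K)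
    (q-ind : FieldOps.Indeterminate K q) →
    let open QHermite K q q-ind in
    ∃ IsMixedMoments
    × (∀ σ → IsMixedMoments σ →
    ∀ n k → k ≤ n → Is-h wᴴ-system n k (σ n k))
proposition5p6 K q q-ind =
  (pathSum , pathSum-mixedMoments) ,
  λ σ σ-mm n k k≤n → columnSum-is-h n k (mixedMoments-unique pathSum-mixedMoments σ-mm k≤n)
  where
  open Hermite K q q-ind
  open PathSums K (QHermite.wᴴ-system K q q-ind)
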